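{- Let $G$ and $H$ be finite simple graphs, and let $G[H]$ denote their lexicographical product. (a) Suppose that $G$ is a graph of isolated vertices (i.e. $G$ has no edges). Then ${\rm Ind}(H)$ is vertex decomposable, respectively shellable, if and only if ${\rm Ind}(G[H])$ is vertex decomposable, respectively shellable. (b) Suppose that $G$ is not a graph of isolated vertices (i.e. $G$ has at least one edge). Then ${\rm Ind}(G[H])$ is vertex decomposable if and only if ${\rm Ind}(G)$ is vertex decomposable and $H = K_m$ for some $m \geq 1$. (c) Suppose that $G$ is not a graph of isolated vertices. If ${\rm Ind}(G)$ is shellable and $H = K_m$, then ${\rm Ind}(G[H])$ is shellable. Furthermore, if ${\rm Ind}(G[H])$ is shellable, then $H = K_m$ for some $m \geq 1$.
   Context: For graphs $G=(V_G,E_G)$ and $H=(V_H,E_H)$, the lexicographical product $G[H]$ is the graph with vertex set $V_G\times V_H$ in which $(w,x)$ and $(y,z)$ are adjacent if $\{w,y\}\in E_G$, or if $w=y$ and $\{x,z\}\in E_H$. $K_m$ denotes the complete graph on $m$ vertices. A set $W\subseteq V_G$ is independent if no edge of $G$ is contained in $W$; the independence complex ${\rm Ind}(G)$ is the simplicial complex of all independent sets of $G$. Facets are maximal faces; a complex is pure if all facets have the same dimension. A pure simplicial complex $\Delta$ is shellable if its facets can be ordered $F_1,\ldots,F_s$ so that for all $1\le j<i\le s$ there exist $x\in F_i\setminus F_j$ and $k\in\{1,\ldots,i-1\}$ with $\{x\}=F_i\setminus F_k$. For a vertex $x$, ${\rm del}_\Delta(x)=\{G\in\Delta : x\notin G\}$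 and ${\rm link}_\Delta(x)=\{G\in\Delta: x\notin G,\ G\cup\{x\}\in\Delta\}$. A pure simplicial complex $\Delta$ is vertex decomposable if either $\Delta$ is a simplex (has a unique facet), or there is a vertex $x$ such that ${\rm del}_\Delta(x)$ and ${\rm link}_\Delta(x)$ are vertex decomposable. -}

module Defs where

open import Data.Nat using (ℕ; _*_; _<_)
open import Data.Bool using (Bool; true; false; _∨_; _∧_)
open import Data.Fin using (Fin; remQuot; _≟_)
import Data.Fin as Fin
open import Data.Fin.Subset using (Subset; _∈_; _∉_; _⊆_; ⁅_⁆; _∪_; _─_; ∣_∣)
open import Data.Product using (Σ; ∃; ∃-syntax; _×_; _,_; proj₁; proj₂)
open import Relation.Nullary using (¬_)
open import Relation.Nullary.Decidable using (⌊_⌋)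
open import Relation.Binary.PropositionalEquality using (_≡_; _≢_)
open import Function.Definitions using (Injective)
open import Level using (0ℓ)
open import Relation.Binary.PropositionalEquality using (refl; cong₂; sym)
open import Relation.Nullary using (yes; no)

record Graph (n : ℕ) : Set where
  field
    adj     : Fin n → Fin n → Bool
    symm    : ∀ x y → adj x y ≡ adj y x
    irrefl  : ∀ x → adj x x ≡ false
open Graph public

Edge : ∀ {n} → Graph n → Fin n → Fin n → Set
Edge G x y = adj G x y ≡ true

EdgeFree : ∀ {n} → Graph n → Set
EdgeFree G = ∀ x y → ¬ Edge G x y

IsComplete : ∀ {m} → Graph m → Set
IsComplete H = ∀ x y → x ≢ y → Edge H x y

lexAdj : ∀ {n m} → Graph n → Graph m → Fin n × Fin m → Fin n × Fin m → Bool
lexAdj G H (w , x) (y , z) = adj G w y ∨ (⌊ w ≟ y ⌋ ∧ adj H x z)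

private
  ≟-sym : ∀ {n} (w y : Fin n) → ⌊ w ≟ y ⌋ ≡ ⌊ y ≟ w ⌋
  ≟-sym w y with w ≟ y | y ≟ w
  ... | yes _ | yes _ = refl
  ... | no _  | no _  = refl
  ... | yes p | no q  with q (sym p)
  ... | ()
  ≟-sym w y | no p | yes q with p (sym q)
  ... | ()

  ≟-refl : ∀ {n} (w : Fin n) → ⌊ w ≟ w ⌋ ≡ true
  ≟-refl w with w ≟ w
  ... | yes _ = refl
  ... | no p with p refl
  ... | ()

  lexAdj-sym : ∀ {n m} (G : Graph n) (H : Graph m) a b → lexAdj G H a b ≡ lexAdj G H b a
  lexAdj-sym G H (w , x) (y , z) =
    cong₂ _∨_ (symm G w y) (cong₂ _∧_ (≟-sym w y) (symm H x z))

  lexAdj-irrefl : ∀ {n m} (G : Graph n) (H : Graph m) a → lexAdj G H a a ≡ false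
  lexAdj-irrefl G H (w , x) rewrite irrefl G w | ≟-refl w | irrefl H x = refl

lexProduct : ∀ {n m} → Graph n → Graph m → Graph (n * m)
lexProduct {n} {m} G H = record
  { adj    = λ a b → lexAdj G H (remQuot m a) (remQuot m b)
  ; symm   = λ a b → lexAdj-sym G H (remQuot m a) (remQuot m b)
  ; irrefl = λ a → lexAdj-irrefl G H (remQuot m a)
  }

syntax lexProduct G H = G [ H ]ₗ

-- Simplicial complexes on the vertex set Fin n, given by their set of
-- faces (a predicate on subsets).

Complex : ℕ → Set₁
Complex n = Subset n → Set

Independent : ∀ {n} → Graph n → Subset n → Set
Independent G W = ∀ x y → x ∈ W → y ∈ W → ¬ Edge G x y

Ind : ∀ {n} → Graph n → Complex n
Ind G = Independent G

IsFacet : ∀ {n} → Complex n → Subset n → Set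
IsFacet Δ F = Δ F × (∀ F′ → Δ F′ → F ⊆ F′ → F′ ≡ F)

Pure : ∀ {n} → Complex n → Set
Pure Δ = ∀ F F′ → IsFacet Δ F → IsFacet Δ F′ → ∣ F ∣ ≡ ∣ F′ ∣

IsSimplex : ∀ {n} → Complex n → Set
IsSimplex Δ = Σ _ λ F → IsFacet Δ F × (∀ F′ → IsFacet Δ F′ → F′ ≡ F)

del : ∀ {n} → Complex n → Fin n → Complex n
del Δ x G = x ∉ G × Δ G

link : ∀ {n} → Complex n → Fin n → Complex n
link Δ x G = x ∉ G × Δ (⁅ x ⁆ ∪ G)

data VertexDecomposable {n : ℕ} : Complex n → Set₁ where
  simplex : ∀ {Δ} → Pure Δ → IsSimplex Δ → VertexDecomposable Δ
  decomp  : ∀ {Δ} → Pure Δ → (x : Fin n) →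
            VertexDecomposable (del Δ x) → VertexDecomposable (link Δ x) →
            VertexDecomposable Δ

IsShelling : ∀ {n} → Complex n → (s : ℕ) → (Fin s → Subset n) → Set
IsShelling Δ s F =
  (∀ i → IsFacet Δ (F i)) × (∀ G → IsFacet Δ G → ∃[ i ] F i ≡ G) × Injective _≡_ _≡_ F ×
  (∀ i j → j Fin.< i → ∃[ x ] (x ∈ F i × x ∉ F j ×
      ∃[ k ] (k Fin.< i × F i ─ F k ≡ ⁅ x ⁆)))

Shellable : ∀ {n} → Complex n → Set
Shellable {n} Δ = Pure Δ × Σ ℕ λ s → Σ (Fin s → Subset n) λ F → IsShelling Δ s F

{-# OPTIONS --safe #-}

-- Sort the vertices of G[H] into rows, one copy of H for each vertex of G. A set is independent
-- in G[H] iff the set of its nonempty rows (its support) is independent in G and every row is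
-- independent in H; it is a facet iff its support and its nonempty rows are facets.
--
-- If G has no edges, Ind(G[H]) is a join of copies of Ind(H), and both properties pass to and from
-- the factors. If H is complete, Ind(G[H]) is Ind(G) with each vertex replaced by copies lying in
-- no common face. For vertex decomposability a copy that has a twin is shed by deletion without
-- changing the underlying complex, and the last copy is shed as the vertex itself; a shelling is
-- obtained lexicographically.
--
-- Conversely, in a vertex decomposable or shellable complex any two facets are joined by steps that
-- each remove a single element. If H is not complete, purity forces every nonempty row of a facet
-- to have at least two elements, so such steps preserve the support; if G has an edge, there are
-- facets with different supports.

module Submission where

open import Defs
open import Data.Nat using (ℕ; zero; suc; _+_; _*_; _≤_; _<_; z≤n; s≤s; s≤s⁻¹)
open import Data.Nat.Properties
  using (+-*-semiring; _≤?_; ≮⇒≥; *-identityʳ; *-zeroʳ; module ≤-Reasoning; ≤-decTotalOrder;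
    ≤-total; m≤m+n; +-cancelˡ-≤; *-monoʳ-≤; *-suc; <⇒≤; ≰⇒>; <-cmp; +-mono-≤; +-mono-<-≤;
    +-mono-≤-<; <⇒≢; ≤∧≢⇒<; ≤-refl; ≤-reflexive; ≤-trans; ≤-antisym; <-≤-trans; ≤-<-trans; <⇒≱;
    +-suc; +-comm; +-monoˡ-≤; m≤n+m; +-identityʳ; +-monoʳ-<)
open import Data.Fin using (Fin; zero; suc; _≟_; toℕ; fromℕ<; combine; remQuot)
open import Data.Fin.Properties
  using (any?; all?; suc-injective; combine-surjective; combine-injectiveˡ; combine-injectiveʳ;
    remQuot-combine; combine-remQuot; toℕ<n; toℕ-injective; toℕ-fromℕ<)
open import Data.Fin.Subset
  using (Subset; Nonempty; ⊤; inside; outside; _∈_; _∉_; _⊆_; _⊂_; ⊥; ⁅_⁆; _∪_; _─_; _-_; ∣_∣)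
open import Data.Fin.Subset.Properties
open import Data.Vec using (tabulate; lookup; concat; _++_; []; _∷_; here; there)
open import Data.Vec.Properties
  using (≡-dec; lookup∘tabulate; tabulate∘lookup; tabulate-cong; lookup-concat; lookup⇒[]=;
    []=⇒lookup)
open import Data.Product using (∃; _×_; _,_; proj₁; proj₂)
open import Data.Bool as Bool using (Bool; true; false)
open import Data.List as List using (List; []; _∷_; cartesianProductWith)
open import Data.List.Membership.Propositional using () renaming (_∈_ to _∈ˡ_)
open import Data.List.Membership.Propositional.Properties
  using (∈-cartesianProductWith⁺; ∈-filter⁺; ∈-filter⁻; ∈-lookup)
open import Data.List.Relation.Unary.All as All using ([]; _∷_)
open import Data.List.Relation.Unary.AllPairs using (AllPairs; []; _∷_)
open import Data.List.Relation.Unary.Any as Any using (here; there)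
open import Data.List.Relation.Unary.Any.Properties using (lookup-index)
open import Data.List.Relation.Unary.Unique.Propositional using (Unique)
open import Data.List.Relation.Unary.Unique.Propositional.Properties
  using (cartesianProductWith⁺; filter⁺)
open import Data.List.Relation.Unary.Sorted.TotalOrder.Properties using (Sorted⇒AllPairs)
open import Data.List.Relation.Binary.Permutation.Propositional using (↭-sym; ↭⇒↭ₛ)
open import Data.List.Relation.Binary.Permutation.Propositional.Properties using (∈-resp-↭)
open import Data.List.Relation.Binary.Permutation.Setoid.Properties using (Unique-resp-↭)
import Data.List.Sort as Sort
open import Data.Vec.Functional using (updateAt)
open import Data.Vec.Functional.Properties
  using (updateAt-updates; updateAt-minimal; updateAt-id-local; updateAt-updateAt-local)
open import Algebra.Properties.Semiring.Sum +-*-semiring using (sum; sum-cong-≗; *-distribˡ-sum)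
open import Data.Empty using (⊥-elim)
open import Data.Sum using (_⊎_; inj₁; inj₂; [_,_]′)
open import Relation.Nullary using (¬_; Dec; yes; no; does; contradiction)
open import Relation.Nullary.Decidable
  using (⌊_⌋; ¬?; _×-dec_; dec-true; decidable-stable; _→-dec_)
open import Relation.Unary using (_≐_)
open import Relation.Unary.Properties using (≐-sym; ≐-trans)
import Relation.Binary.Construct.On as On
open import Relation.Binary.Bundles using (DecTotalOrder)
open import Relation.Binary.Definitions using (tri<; tri≈; tri>)
open import Relation.Binary.PropositionalEquality
open import Function using (_∘_; id)
open import Function.Bundles using (_⇔_; mk⇔)

private variable
  n m N : ℕ

-- Finite subsets

select : {P : Fin n → Set} → (∀ x → Dec (P x)) → Subset n
select P? = tabulate (does ∘ P?)

∈-select⁺ : {P : Fin n → Set} (P? : ∀ x → Dec (P x)) → ∀ {x} → P x → x ∈ select P?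
∈-select⁺ P? {x} p =
  lookup⇒[]= x _ (trans (lookup∘tabulate (does ∘ P?) x) (dec-true (P? x) p))

∈-select⁻ : {P : Fin n → Set} (P? : ∀ x → Dec (P x)) → ∀ {x} → x ∈ select P? → P x
∈-select⁻ P? {x} x∈ with P? x | trans (sym (lookup∘tabulate (does ∘ P?) x)) ([]=⇒lookup x∈)
... | yes p | _ = p
... | no _  | ()

∈-insert : (x : Fin n) (F : Subset n) → x ∈ ⁅ x ⁆ ∪ F
∈-insert x F = p⊆p∪q F (x∈⁅x⁆ x)

⊆-insert : (x : Fin n) (F : Subset n) → F ⊆ ⁅ x ⁆ ∪ F
⊆-insert x F = q⊆p∪q ⁅ x ⁆ F

∈-insert⁻ : ∀ {x y : Fin n} F → y ∈ ⁅ x ⁆ ∪ F → y ≡ x ⊎ y ∈ F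
∈-insert⁻ {x = x} F y∈ with x∈p∪q⁻ ⁅ x ⁆ F y∈
... | inj₁ y∈x = inj₁ (x∈⁅y⁆⇒x≡y x y∈x)
... | inj₂ y∈F = inj₂ y∈F

insert-⊆ : ∀ {x : Fin n} {F K} → x ∈ K → F ⊆ K → ⁅ x ⁆ ∪ F ⊆ K
insert-⊆ {F = F} x∈K F⊆K y∈ with ∈-insert⁻ F y∈
... | inj₁ refl = x∈K
... | inj₂ y∈F  = F⊆K y∈F

∈-remove⁻ : ∀ (F : Subset n) {x y} → y ∈ F - x → y ∈ F × y ≢ x
∈-remove⁻ (inside  ∷ F) {suc x} here       = here , λ ()
∈-remove⁻ (inside  ∷ F) {zero}  (there y∈) = there (p─q⊆p F ⊥ y∈) , λ ()
∈-remove⁻ (outside ∷ F) {zero}  (there y∈) = there (p─q⊆p F ⊥ y∈) , λ ()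
∈-remove⁻ (_       ∷ F) {suc x} (there y∈) with y∈F , y≢x ← ∈-remove⁻ F y∈ =
  there y∈F , λ { refl → y≢x refl }

∉-remove : ∀ (F : Subset n) x → x ∉ F - x
∉-remove F x x∈ = proj₂ (∈-remove⁻ F x∈) refl

insert-remove : ∀ {F : Subset n} {x} → x ∈ F → ⁅ x ⁆ ∪ (F - x) ≡ F
insert-remove {F = F} {x} x∈F =
  ⊆-antisym (insert-⊆ x∈F (proj₁ ∘ ∈-remove⁻ F)) λ {y} → from y
  where
  from : ∀ y → y ∈ F → y ∈ ⁅ x ⁆ ∪ (F - x)
  from y y∈F with y ≟ x
  ... | yes refl = ∈-insert x _
  ... | no y≢x   = ⊆-insert x _ (x∈p∧x≢y⇒x∈p-y y∈F y≢x)

∈─⇒∉ : ∀ (F K : Subset n) {x} → x ∈ F ─ K → x ∉ K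
∈─⇒∉ (_ ∷ F) (outside ∷ K) (there x∈) (there x∈K) = ∈─⇒∉ F K x∈ x∈K
∈─⇒∉ (_ ∷ F) (inside ∷ K)  (there x∈) (there x∈K) = ∈─⇒∉ F K x∈ x∈K

⊆-remove : ∀ {F K : Subset n} {x} → F ⊆ K → x ∉ F → F ⊆ K - x
⊆-remove F⊆K x∉F y∈F = x∈p∧x≢y⇒x∈p-y (F⊆K y∈F) λ { refl → x∉F y∈F }

⊄⇒⊇ : {F K : Subset n} → F ⊆ K → ¬ F ⊂ K → K ⊆ F
⊄⇒⊇ {F = F} F⊆K F⊄K {y} y∈K with y ∈? F
... | yes y∈F = y∈F
... | no y∉F  = ⊥-elim (F⊄K (F⊆K , y , y∈K , y∉F))

⊆∧∣∣≤⇒≡ : {F K : Subset n} → F ⊆ K → ∣ K ∣ ≤ ∣ F ∣ → F ≡ K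
⊆∧∣∣≤⇒≡ F⊆K ∣K∣≤∣F∣ =
  ⊆-antisym F⊆K (⊄⇒⊇ F⊆K λ F⊂K → <⇒≱ (p⊂q⇒∣p∣<∣q∣ F⊂K) ∣K∣≤∣F∣)

-- By induction on `F`: the partner of the first element is deleted from `K`, and injectivity keeps
-- the partners of the remaining elements in what is left. A relation replaces a function because
-- partners are only known to exist for elements of `F`.
∣∣-injection : (R : Fin N → Fin n → Set) (F : Subset N) (K : Subset n) →
  (∀ {x} → x ∈ F → ∃ λ y → y ∈ K × R x y) →
  (∀ {x x′ y} → x ∈ F → x′ ∈ F → R x y → R x′ y → x ≡ x′) →
  ∣ F ∣ ≤ ∣ K ∣
∣∣-injection R []            K tot inj = z≤n
∣∣-injection R (outside ∷ F) K tot inj =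
  ∣∣-injection (R ∘ suc) F K (tot ∘ there)
    λ x∈ x′∈ r r′ → suc-injective (inj (there x∈) (there x′∈) r r′)
∣∣-injection R (inside ∷ F) K tot inj with y , y∈K , r ← tot here =
  ≤-trans (s≤s (∣∣-injection (R ∘ suc) F (K - y) tot′
      λ x∈ x′∈ r r′ → suc-injective (inj (there x∈) (there x′∈) r r′)))
    (x∈p⇒∣p-x∣<∣p∣ y∈K)
  where
  tot′ : ∀ {x} → x ∈ F → ∃ λ z → z ∈ K - y × R (suc x) z
  tot′ x∈F with z , z∈K , r′ ← tot (there x∈F) =
    z , x∈p∧x≢y⇒x∈p-y z∈K (λ { refl → contradiction (inj here (there x∈F) r r′) λ () }) , r′

-- Simplicial complexes

-- Decidable membership is what allows `extend` to find facets constructively.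
record Simplicial (Δ : Complex n) : Set where
  field
    dec  : ∀ F → Dec (Δ F)
    down : ∀ {F K} → K ⊆ F → Δ F → Δ K
open Simplicial

-- Complexes are predicates, so complexes with the same faces need not be propositionally equal;
-- properties are carried along `≐` instead.
facet-resp : {Δ Γ : Complex n} → Δ ≐ Γ → ∀ {F} → IsFacet Δ F → IsFacet Γ F
facet-resp (to , from) (ΔF , max) = to ΔF , λ K ΓK → max K (from ΓK)

pure-resp : {Δ Γ : Complex n} → Δ ≐ Γ → Pure Δ → Pure Γ
pure-resp e pure F K fF fK = pure F K (facet-resp (≐-sym e) fF) (facet-resp (≐-sym e) fK)

del-resp : {Δ Γ : Complex n} → Δ ≐ Γ → ∀ x → del Δ x ≐ del Γ x
del-resp (to , from) x = (λ (x∉ , f) → x∉ , to f) , (λ (x∉ , f) → x∉ , from f)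

link-resp : {Δ Γ : Complex n} → Δ ≐ Γ → ∀ x → link Δ x ≐ link Γ x
link-resp (to , from) x = (λ (x∉ , f) → x∉ , to f) , (λ (x∉ , f) → x∉ , from f)

del-simplicial : {Δ : Complex n} → Simplicial Δ → ∀ x → Simplicial (del Δ x)
del-simplicial S x = record
  { dec  = λ F → ¬? (x ∈? F) ×-dec dec S F
  ; down = λ K⊆F (x∉F , f) → x∉F ∘ K⊆F , down S K⊆F f
  }

link-simplicial : {Δ : Complex n} → Simplicial Δ → ∀ x → Simplicial (link Δ x)
link-simplicial S x = record
  { dec  = λ F → ¬? (x ∈? F) ×-dec dec S (⁅ x ⁆ ∪ F)
  ; down = λ {F} K⊆F (x∉F , f) →
      x∉F ∘ K⊆F , down S (insert-⊆ (∈-insert x F) (⊆-insert x F ∘ K⊆F)) f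
  }

-- A face with no proper superset among the faces is a facet; otherwise a decidable search finds a
-- larger face. The fuel `k` bounds the number of vertices outside `F`, which drops with each
-- enlargement.
extend : {Δ : Complex n} → Simplicial Δ → ∀ {F} → Δ F → ∃ λ K → F ⊆ K × IsFacet Δ K
extend {n} {Δ} S {F} = go n F (m≤n+m n ∣ F ∣)
  where
  go : ∀ k F → n ≤ ∣ F ∣ + k → Δ F → ∃ λ K → F ⊆ K × IsFacet Δ K
  go k F n≤ f with anySubset? (λ K → (F ⊂? K) ×-dec dec S K)
  ... | no  none = F , id , f , λ K g F⊆K →
    ⊆-antisym (⊄⇒⊇ F⊆K λ F⊂K → none (K , F⊂K , g)) F⊆K
  go zero F n≤ f | yes (K , F⊂K , g) =
    contradiction (∣p∣≤n K)
      (<⇒≱ (≤-<-trans (subst (n ≤_) (+-identityʳ ∣ F ∣) n≤) (p⊂q⇒∣p∣<∣q∣ F⊂K)))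
  go (suc k) F n≤ f | yes (K , F⊂K , g)
    with L , K⊆L , fL ← go k K
           (≤-trans (subst (n ≤_) (+-suc ∣ F ∣ k) n≤) (+-monoˡ-≤ k (p⊂q⇒∣p∣<∣q∣ F⊂K))) g
    = L , (λ x∈F → K⊆L (proj₁ F⊂K x∈F)) , fL

link-facet⁺ : {Δ : Complex n} → ∀ {x F} → x ∈ F → IsFacet Δ F → IsFacet (link Δ x) (F - x)
link-facet⁺ {Δ = Δ} {x} {F} x∈F (f , max) =
  (∉-remove F x , subst Δ (sym (insert-remove x∈F)) f) , λ K (x∉K , g) F-x⊆K →
    let K∪x≡F : ⁅ x ⁆ ∪ K ≡ F
        K∪x≡F = max (⁅ x ⁆ ∪ K) g
          (subst (_⊆ ⁅ x ⁆ ∪ K) (insert-remove x∈F)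
            (insert-⊆ (∈-insert x K) (⊆-insert x K ∘ F-x⊆K)))
    in ⊆-antisym (subst (λ L → K ⊆ L - x) K∪x≡F (⊆-remove (⊆-insert x K) x∉K)) F-x⊆K

link-facet⁻ : {Δ : Complex n} → ∀ {x G} → IsFacet (link Δ x) G → IsFacet Δ (⁅ x ⁆ ∪ G)
link-facet⁻ {Δ = Δ} {x} {G} ((x∉G , f) , max) = f , λ K g ⊆K →
  let x∈K : x ∈ K
      x∈K = ⊆K (∈-insert x G)
      K-x≡G : K - x ≡ G
      K-x≡G = max (K - x) (∉-remove K x , subst Δ (sym (insert-remove x∈K)) g)
                (⊆-remove (⊆K ∘ ⊆-insert x G) x∉G)
  in trans (sym (insert-remove x∈K)) (cong (⁅ x ⁆ ∪_) K-x≡G)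

del-facet⁺ : {Δ : Complex n} → ∀ {x F} → x ∉ F → IsFacet Δ F → IsFacet (del Δ x) F
del-facet⁺ x∉F (f , max) = (x∉F , f) , λ K (_ , g) → max K g

-- If x is not a cone point, purity makes every facet of the deletion a facet.
del-facet⁻ : {Δ : Complex n} → Simplicial Δ → Pure Δ → ∀ {x} → Pure (del Δ x) →
  ∀ {F} → x ∉ F → IsFacet Δ F → ∀ {K} → IsFacet (del Δ x) K → IsFacet Δ K
del-facet⁻ {Δ = Δ} S pure pure-del {F = F} x∉F fF {K} fK@((_ , k) , _) = k , λ L l K⊆L →
  let M , L⊆M , fM = extend S l
      K≡M : K ≡ M
      -- `F` is a facet both of `Δ` and of the deletion, so the two purities give `K` and `M` the
      -- same size.
      K≡M = ⊆∧∣∣≤⇒≡ (L⊆M ∘ K⊆L)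
        (≤-reflexive (trans (pure M F fM fF) (pure-del F K (del-facet⁺ x∉F fF) fK)))
  in ⊆-antisym (subst (L ⊆_) (sym K≡M) L⊆M) K⊆L

-- Vertex decomposability

VD-resp : {Δ Γ : Complex n} → Δ ≐ Γ → VertexDecomposable Δ → VertexDecomposable Γ
VD-resp e (simplex pure (F , fF , uniq)) =
  simplex (pure-resp e pure)
    (F , facet-resp e fF , λ K fK → uniq K (facet-resp (≐-sym e) fK))
VD-resp e (decomp pure x d l) =
  decomp (pure-resp e pure) x (VD-resp (del-resp e x) d) (VD-resp (link-resp e x) l)

VD-pure : {Δ : Complex n} → VertexDecomposable Δ → Pure Δ
VD-pure (simplex pure _)    = pure
VD-pure (decomp pure _ _ _) = pure

VD-facet : {Δ : Complex n} → VertexDecomposable Δ → ∃ (IsFacet Δ)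
VD-facet (simplex _ (F , fF , _)) = F , fF
VD-facet {Δ = Δ} (decomp _ x _ l) with G , fG ← VD-facet l = ⁅ x ⁆ ∪ G , link-facet⁻ {Δ = Δ} fG

-- Simplices are shed down to {∅} as well, which leaves a single base case.
data FullyDecomposable {n : ℕ} : Complex n → Set₁ where
  trivial : ∀ {Δ} → Δ ≐ (_≡ ⊥) → FullyDecomposable Δ
  shed    : ∀ {Δ} → Pure Δ → (x : Fin n) → FullyDecomposable (del Δ x) →
            FullyDecomposable (link Δ x) → FullyDecomposable Δ

FD-resp : {Δ Γ : Complex n} → Δ ≐ Γ → FullyDecomposable Δ → FullyDecomposable Γ
FD-resp e (trivial t)       = trivial (≐-trans (≐-sym e) t)
FD-resp e (shed pure x d l) =
  shed (pure-resp e pure) x (FD-resp (del-resp e x) d) (FD-resp (link-resp e x) l)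

-- At a vertex `x` of `F`, deletion and link of the simplex on `F` are both the simplex on `F - x`,
-- so one recursive call serves for both.
FD-powerset : (F : Subset n) → FullyDecomposable (_⊆ F)
FD-powerset F = go ∣ F ∣ F ≤-refl
  where
  top : ∀ {F K : Subset _} → IsFacet (_⊆ F) K → F ≡ K
  top {F} (K⊆F , max) = max F id K⊆F
  go : ∀ k F → ∣ F ∣ ≤ k → FullyDecomposable (_⊆ F)
  go k F ∣F∣≤k with nonempty? F
  ... | no empty with refl ← Empty-unique empty =
    trivial ((λ {K} K⊆⊥ → ⊆-antisym {i = K} K⊆⊥ (⊆-min K)) , λ { refl → id })
  go zero    F ∣F∣≤k | yes (x , x∈F) = ⊥-elim (<⇒≱ (x∈p⇒∣p-x∣<∣p∣ x∈F) (≤-trans ∣F∣≤k z≤n))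
  go (suc k) F ∣F∣≤k | yes (x , x∈F) =
    shed (λ K L fK fL → cong ∣_∣ (trans (sym (top fK)) (top fL))) x
      (FD-resp {Δ = _⊆ (F - x)}
        ((λ K⊆ → (λ x∈K → ∉-remove F x (K⊆ x∈K)) , λ y∈K → proj₁ (∈-remove⁻ F (K⊆ y∈K))) ,
         (λ { (x∉K , K⊆F) → ⊆-remove K⊆F x∉K }))
        rec)
      (FD-resp {Δ = _⊆ (F - x)}
        ((λ K⊆ → (λ x∈K → ∉-remove F x (K⊆ x∈K)) ,
                 insert-⊆ x∈F λ y∈K → proj₁ (∈-remove⁻ F (K⊆ y∈K))) ,
         (λ { {K} (x∉K , ⊆F) → ⊆-remove (λ y∈K → ⊆F (⊆-insert x K y∈K)) x∉K }))
        rec)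
    where
    rec : FullyDecomposable (_⊆ (F - x))
    rec = go k (F - x) (s≤s⁻¹ (<-≤-trans (x∈p⇒∣p-x∣<∣p∣ x∈F) ∣F∣≤k))

-- Applied to the link of a shed vertex, this shows that the vertex lies in some face.
FD-face : {Δ : Complex n} → FullyDecomposable Δ → ∃ Δ
FD-face (trivial (_ , from)) = ⊥ , from refl
FD-face (shed _ _ d _) with F , _ , f ← FD-face d = F , f

VD-trivial : {Δ : Complex n} → Δ ≐ (_≡ ⊥) → VertexDecomposable Δ
VD-trivial (to , from) =
  simplex (λ _ _ fF fK → cong ∣_∣ (trans (to (proj₁ fF)) (sym (to (proj₁ fK)))))
    (⊥ , (from refl , λ _ k _ → to k) , λ _ fK → to (proj₁ fK))

FD-pure : {Δ : Complex n} → FullyDecomposable Δ → Pure Δ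
FD-pure (trivial t)       = VD-pure (VD-trivial t)
FD-pure (shed pure _ _ _) = pure

-- Every face extends to a facet, so a complex with a unique facet `F` consists of all subsets of
-- `F`.
VD⇒FD : {Δ : Complex n} → Simplicial Δ → VertexDecomposable Δ → FullyDecomposable Δ
VD⇒FD {Δ = Δ} S (simplex _ (F , (f , _) , uniq)) =
  FD-resp {Δ = _⊆ F} ((λ K⊆F → down S K⊆F f) , to) (FD-powerset F)
  where
  to : ∀ {K} → Δ K → K ⊆ F
  to {K} k with L , K⊆L , fL ← extend S k = subst (K ⊆_) (uniq L fL) K⊆L
VD⇒FD S (decomp pure x d l) =
  shed pure x (VD⇒FD (del-simplicial S x) d) (VD⇒FD (link-simplicial S x) l)

-- Connectivity in codimension one

-- The equation `F ─ K ≡ ⁅ x ⁆` in elementwise form, which passes more easily through links, rows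
-- and supports.
Sheds : Fin n → Subset n → Subset n → Set
Sheds x F K = x ∈ F × x ∉ K × (∀ y → y ∈ F → y ≢ x → y ∈ K)

sheds⇒─≡ : ∀ {x : Fin n} {F K} → Sheds x F K → F ─ K ≡ ⁅ x ⁆
sheds⇒─≡ {x = x} {F} {K} (x∈F , x∉K , rest) = ⊆-antisym to from
  where
  to : F ─ K ⊆ ⁅ x ⁆
  to {y} y∈ with y ≟ x
  ... | yes refl = x∈⁅x⁆ x
  ... | no y≢x   = contradiction (rest y (p─q⊆p F K y∈) y≢x) (∈─⇒∉ F K y∈)
  from : ⁅ x ⁆ ⊆ F ─ K
  from y∈ with refl ← x∈⁅y⁆⇒x≡y x y∈ = x∈p∧x∉q⇒x∈p─q x∈F x∉K

─≡⇒sheds : ∀ {x : Fin n} {F K} → F ─ K ≡ ⁅ x ⁆ → Sheds x F K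
─≡⇒sheds {x = x} {F} {K} e = p─q⊆p F K x∈ , ∈─⇒∉ F K x∈ , rest
  where
  x∈ : x ∈ F ─ K
  x∈ = subst (x ∈_) (sym e) (x∈⁅x⁆ x)
  rest : ∀ y → y ∈ F → y ≢ x → y ∈ K
  rest y y∈F y≢x with y ∈? K
  ... | yes y∈K = y∈K
  ... | no y∉K  = contradiction (x∈⁅y⁆⇒x≡y x (subst (y ∈_) e (x∈p∧x∉q⇒x∈p─q y∈F y∉K))) y≢x

-- Stated through the functions φ invariant under single steps instead of through paths.
Connected : Complex n → Set₁
Connected {n} Δ = ∀ {A : Set} (φ : Subset n → A) →
  (∀ {F K x} → IsFacet Δ F → IsFacet Δ K → Sheds x F K → φ F ≡ φ K) →
  ∀ {F K} → IsFacet Δ F → IsFacet Δ K → φ F ≡ φ K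

-- Induction on the decomposition. Facets avoiding `x` are connected through the deletion, facets
-- containing `x` through the link. A facet `F` through `x` is one step away from a facet avoiding
-- `x`, obtained by extending `F - x` in the deletion.
VD⇒connected : {Δ : Complex n} → Simplicial Δ → VertexDecomposable Δ → Connected Δ
VD⇒connected S (simplex _ (_ , _ , uniq)) φ adj fF fK =
  cong φ (trans (uniq _ fF) (sym (uniq _ fK)))
VD⇒connected {Δ = Δ} S (decomp pure x d l) φ adj {F} {K} fF fK = cases (x ∈? F) (x ∈? K)
  where
  both-out : ∀ {F K} → x ∉ F → IsFacet Δ F → x ∉ K → IsFacet Δ K → φ F ≡ φ K
  both-out x∉F fF x∉K fK =
    VD⇒connected (del-simplicial S x) d φ (λ f g → adj (lift f) (lift g))
      (del-facet⁺ x∉F fF) (del-facet⁺ x∉K fK)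
    where
    lift : ∀ {L} → IsFacet (del Δ x) L → IsFacet Δ L
    lift = del-facet⁻ S pure (VD-pure d) x∉F fF
  both-in : ∀ {F K} → x ∈ F → IsFacet Δ F → x ∈ K → IsFacet Δ K → φ F ≡ φ K
  both-in x∈F fF x∈K fK =
    subst₂ (λ F K → φ F ≡ φ K) (insert-remove x∈F) (insert-remove x∈K)
      (VD⇒connected (link-simplicial S x) l (φ ∘ (⁅ x ⁆ ∪_)) adj′
        (link-facet⁺ {Δ = Δ} x∈F fF) (link-facet⁺ {Δ = Δ} x∈K fK))
    where
    adj′ : ∀ {F K y} → IsFacet (link Δ x) F → IsFacet (link Δ x) K → Sheds y F K →
      φ (⁅ x ⁆ ∪ F) ≡ φ (⁅ x ⁆ ∪ K)
    adj′ {F} {K} {y} fF@((x∉F , _) , _) fK (y∈F , y∉K , rest) =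
      adj (link-facet⁻ {Δ = Δ} fF) (link-facet⁻ {Δ = Δ} fK)
        ( ⊆-insert x F y∈F
        , (λ y∈ → [ (λ { refl → x∉F y∈F }) , y∉K ]′ (∈-insert⁻ K y∈))
        , λ z z∈ z≢y → [ (λ { refl → ∈-insert x K })
                       , (λ z∈F → ⊆-insert x K (rest z z∈F z≢y)) ]′ (∈-insert⁻ F z∈))
  in-out : ∀ {F K} → x ∈ F → IsFacet Δ F → x ∉ K → IsFacet Δ K → φ F ≡ φ K
  in-out {F} {K} x∈F fF x∉K fK
    with L , F-x⊆L , fL@((x∉L , _) , _) ← extend (del-simplicial S x) {F - x}
           (∉-remove F x , down S (λ y∈ → proj₁ (∈-remove⁻ F y∈)) (proj₁ fF)) =
    trans (adj fF fL′ (x∈F , x∉L , λ y y∈F y≢x → F-x⊆L (x∈p∧x≢y⇒x∈p-y y∈F y≢x)))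
      (both-out x∉L fL′ x∉K fK)
    where
    fL′ : IsFacet Δ L
    -- As the facet `K` avoids `x`, every facet of the deletion is a facet of `Δ`.
    fL′ = del-facet⁻ S pure (VD-pure d) x∉K fK fL
  cases : Dec (x ∈ F) → Dec (x ∈ K) → φ F ≡ φ K
  cases (yes x∈F) (yes x∈K) = both-in x∈F fF x∈K fK
  cases (yes x∈F) (no x∉K)  = in-out x∈F fF x∉K fK
  cases (no x∉F)  (yes x∈K) = sym (in-out x∈K fK x∉F fF)
  cases (no x∉F)  (no x∉K)  = both-out x∉F fF x∉K fK

-- Blowing up vertices along a map of vertex sets

module Blowup (q : Fin N → Fin n) where

  hits : (F : Subset N) → ∀ y → Dec (∃ λ a → a ∈ F × q a ≡ y)
  hits F y = any? λ a → (a ∈? F) ×-dec (q a ≟ y)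

  image : Subset N → Subset n
  image F = select (hits F)

  ∈-image⁺ : ∀ {F a} → a ∈ F → q a ∈ image F
  ∈-image⁺ {F} {a} a∈F = ∈-select⁺ (hits F) (a , a∈F , refl)

  ∈-image⁻ : ∀ {F y} → y ∈ image F → ∃ λ a → a ∈ F × q a ≡ y
  ∈-image⁻ {F} = ∈-select⁻ (hits F)

  image-mono : ∀ {F K} → F ⊆ K → image F ⊆ image K
  image-mono F⊆K y∈ with a , a∈F , refl ← ∈-image⁻ y∈ = ∈-image⁺ (F⊆K a∈F)

  image-insert : ∀ a F → image (⁅ a ⁆ ∪ F) ≡ ⁅ q a ⁆ ∪ image F
  image-insert a F =
    ⊆-antisym to (insert-⊆ (∈-image⁺ (∈-insert a F)) (image-mono (⊆-insert a F)))
    where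
    to : image (⁅ a ⁆ ∪ F) ⊆ ⁅ q a ⁆ ∪ image F
    to y∈ with b , b∈ , refl ← ∈-image⁻ y∈ with ∈-insert⁻ F b∈
    ... | inj₁ refl = ∈-insert (q a) (image F)
    ... | inj₂ b∈F  = ⊆-insert (q a) (image F) (∈-image⁺ b∈F)

  InjectiveOn : Subset N → Set
  InjectiveOn F = ∀ a b → a ∈ F → b ∈ F → q a ≡ q b → a ≡ b

  injectiveOn-⊆ : ∀ {F K} → K ⊆ F → InjectiveOn F → InjectiveOn K
  injectiveOn-⊆ K⊆F inj a b a∈K b∈K = inj a b (K⊆F a∈K) (K⊆F b∈K)

  injectiveOn-insert : ∀ {a F} → q a ∉ image F → InjectiveOn F → InjectiveOn (⁅ a ⁆ ∪ F)
  injectiveOn-insert {a} {F} qa∉ inj b c b∈ c∈ e with ∈-insert⁻ F b∈ | ∈-insert⁻ F c∈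
  ... | inj₁ refl | inj₁ refl = refl
  ... | inj₁ refl | inj₂ c∈F  = contradiction (subst (_∈ image F) (sym e) (∈-image⁺ c∈F)) qa∉
  ... | inj₂ b∈F  | inj₁ refl = contradiction (subst (_∈ image F) e (∈-image⁺ b∈F)) qa∉
  ... | inj₂ b∈F  | inj₂ c∈F  = inj b c b∈F c∈F e

  ∣image∣ : ∀ {F} → InjectiveOn F → ∣ image F ∣ ≡ ∣ F ∣
  ∣image∣ {F} inj = ≤-antisym
    (∣∣-injection (λ y a → q a ≡ y) (image F) F ∈-image⁻ λ { _ _ refl refl → refl })
    (∣∣-injection (λ a y → q a ≡ y) F (image F) (λ a∈F → _ , ∈-image⁺ a∈F , refl)
      λ { a∈F b∈F refl e → inj _ _ a∈F b∈F (sym e) })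

  -- `S` is the set of copies still present, so that copies can be removed one at a time.
  -- Injectivity forbids two copies of one vertex in a common face.
  Blow : Subset N → Complex n → Complex N
  Blow S Δ F = F ⊆ S × InjectiveOn F × Δ (image F)

  -- The induced subcomplex on `T`. With `T` the image of `S` it is the complex underlying
  -- `Blow S Δ`: only vertices that still have a copy remain.
  Restrict : Subset n → Complex n → Complex n
  Restrict T Δ K = K ⊆ T × Δ K

  blow-simplicial : ∀ {S Δ} → Simplicial Δ → Simplicial (Blow S Δ)
  blow-simplicial {S} simp = record
    { dec  = λ F → (F ⊆? S) ×-dec
                   (all? λ a → all? λ b →
                     (a ∈? F) →-dec ((b ∈? F) →-dec ((q a ≟ q b) →-dec (a ≟ b)))) ×-dec
                   dec simp (image F)
    ; down = λ { {F} {K} K⊆F (F⊆S , inj , f) →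
                 (λ x∈K → F⊆S (K⊆F x∈K)) , injectiveOn-⊆ {F} K⊆F inj , down simp (image-mono K⊆F) f }
    }

  -- A maximal face over the simplex on K must hit every element of K.
  lift : ∀ {S K F} → K ⊆ image S → F ⊆ S → InjectiveOn F → image F ⊆ K →
    ∃ λ L → F ⊆ L × L ⊆ S × InjectiveOn L × image L ≡ K
  lift {S} {K} {F} K⊆ F⊆S inj im⊆
    with L , F⊆L , (L⊆S , injL , imL⊆K) , max ← extend
           (blow-simplicial {S} {_⊆ K} (record { dec = _⊆? K ; down = λ a b y → b (a y) }))
           {F} ((λ {x} → F⊆S {x}) , inj , (λ {x} → im⊆ {x}))
    = L , F⊆L , L⊆S , injL , ⊆-antisym imL⊆K (λ {y} → onto y)
    where
    onto : ∀ y → y ∈ K → y ∈ image L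
    onto y y∈K with y ∈? image L
    ... | yes y∈ = y∈
    ... | no y∉ with a , a∈S , refl ← ∈-image⁻ (K⊆ y∈K) =
      contradiction (∈-image⁺ (subst (a ∈_) (max (⁅ a ⁆ ∪ L) face (⊆-insert a L)) (∈-insert a L))) y∉
      where
      face : Blow S (_⊆ K) (⁅ a ⁆ ∪ L)
      face = insert-⊆ a∈S L⊆S , injectiveOn-insert y∉ injL ,
             subst (_⊆ K) (sym (image-insert a L)) (insert-⊆ y∈K imL⊆K)

  -- A larger face has the same image by maximality, and injectivity leaves no room for a second
  -- copy over it.
  blow-facet⁺ : ∀ {S Δ F} → F ⊆ S → InjectiveOn F →
    IsFacet (Restrict (image S) Δ) (image F) → IsFacet (Blow S Δ) F
  blow-facet⁺ {S} {Δ} {F} F⊆S inj ((_ , f) , max) =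
    ((λ {x} → F⊆S {x}) , inj , f) , λ K (K⊆S , injK , k) F⊆K →
      let imK≡imF : image K ≡ image F
          imK≡imF = max (image K) (image-mono K⊆S , k) (image-mono F⊆K)
          K⊆F : ∀ a → a ∈ K → a ∈ F
          K⊆F a a∈K =
            let b , b∈F , e = ∈-image⁻ (subst (q a ∈_) imK≡imF (∈-image⁺ a∈K))
            in subst (_∈ F) (injK b a (F⊆K b∈F) a∈K e) b∈F
      in ⊆-antisym (λ {a} → K⊆F a) F⊆K

  -- A larger face of the underlying complex would lift to a face above `F`.
  blow-facet⁻ : ∀ {S Δ F} → IsFacet (Blow S Δ) F → IsFacet (Restrict (image S) Δ) (image F)
  blow-facet⁻ {S} {Δ} {F} ((F⊆S , inj , f) , max) =
    (image-mono F⊆S , f) , λ K (K⊆ , k) im⊆K →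
      let L , F⊆L , L⊆S , injL , e = lift K⊆ F⊆S inj im⊆K
      in trans (sym e) (cong image (max L ((λ {x} → L⊆S {x}) , injL , subst Δ (sym e) k) F⊆L))

  lift-facet : ∀ {S Δ K} → IsFacet (Restrict (image S) Δ) K →
    ∃ λ L → IsFacet (Blow S Δ) L × image L ≡ K
  lift-facet {S} {Δ} {K} fK@((K⊆ , _) , _)
    with L , _ , L⊆S , inj , refl ← lift {S} {K} {⊥} K⊆ (λ x∈ → ⊥-elim (∉⊥ x∈))
           (λ _ _ a∈ → ⊥-elim (∉⊥ a∈))
           (λ y∈ → ⊥-elim (∉⊥ (proj₁ (proj₂ (∈-image⁻ {⊥} y∈)))))
    = L , blow-facet⁺ L⊆S inj fK , refl

  blow-pure⁺ : ∀ {S Δ} → Pure (Restrict (image S) Δ) → Pure (Blow S Δ)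
  blow-pure⁺ pure F K fF@((_ , injF , _) , _) fK@((_ , injK , _) , _) =
    trans (sym (∣image∣ injF))
      (trans (pure (image F) (image K) (blow-facet⁻ fF) (blow-facet⁻ fK)) (∣image∣ injK))

  blow-pure⁻ : ∀ {S Δ} → Pure (Blow S Δ) → Pure (Restrict (image S) Δ)
  blow-pure⁻ pure F K fF fK
    with L , fL@((_ , injL , _) , _) , refl ← lift-facet fF
       | M , fM@((_ , injM , _) , _) , refl ← lift-facet fK =
    trans (∣image∣ injL) (trans (pure L M fL fM) (sym (∣image∣ injM)))

  -- Deletions, links and twins in a blow-up

  del-blow : ∀ S Δ a → del (Blow S Δ) a ≐ Blow (S - a) Δ
  del-blow S Δ a = (λ {F} → to F) , (λ {F} → from F)
    where
    to : ∀ F → del (Blow S Δ) a F → Blow (S - a) Δ F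
    to F (a∉F , F⊆S , inj , f) = ⊆-remove F⊆S a∉F , inj , f
    from : ∀ F → Blow (S - a) Δ F → del (Blow S Δ) a F
    from F (F⊆ , inj , f) =
      (λ a∈F → ∉-remove S a (F⊆ a∈F)) , (λ x∈F → proj₁ (∈-remove⁻ S (F⊆ x∈F))) , inj , f

  -- By injectivity no face of the link of `a` contains another copy of `q a`. On the right this is
  -- the condition `q a ∉ image F` contained in `link Δ (q a)`.
  link-blow : ∀ S Δ a → a ∈ S → link (Blow S Δ) a ≐ Blow (S - a) (link Δ (q a))
  link-blow S Δ a a∈S = (λ {F} → to F) , (λ {F} → from F)
    where
    to : ∀ F → link (Blow S Δ) a F → Blow (S - a) (link Δ (q a)) F
    to F (a∉F , ⊆S , inj , f) =
      ⊆-remove (λ x∈F → ⊆S (⊆-insert a F x∈F)) a∉F ,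
      injectiveOn-⊆ (⊆-insert a F) inj ,
      (λ qa∈ → let b , b∈F , e = ∈-image⁻ qa∈ in
        a∉F (subst (_∈ F) (inj b a (⊆-insert a F b∈F) (∈-insert a F) e) b∈F)) ,
      subst Δ (image-insert a F) f
    from : ∀ F → Blow (S - a) (link Δ (q a)) F → link (Blow S Δ) a F
    from F (F⊆ , inj , qa∉ , f) =
      (λ a∈F → ∉-remove S a (F⊆ a∈F)) ,
      insert-⊆ a∈S (λ x∈F → proj₁ (∈-remove⁻ S (F⊆ x∈F))) ,
      injectiveOn-insert qa∉ inj , subst Δ (sym (image-insert a F)) f

  -- Decides what deleting `a` does below: while a twin remains the image of `S` is unchanged, and
  -- without one the deletion removes `q a`.
  Twin : Subset N → Fin N → Fin N → Set
  Twin S a b = b ∈ S × b ≢ a × q b ≡ q a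

  twin? : ∀ S a → Dec (∃ (Twin S a))
  twin? S a = any? λ b → (b ∈? S) ×-dec ¬? (b ≟ a) ×-dec (q b ≟ q a)

  ∈-image-remove⁺ : ∀ {S a y} → y ∈ image S → y ≢ q a → y ∈ image (S - a)
  ∈-image-remove⁺ y∈ y≢ with b , b∈S , refl ← ∈-image⁻ y∈ =
    ∈-image⁺ (x∈p∧x≢y⇒x∈p-y b∈S λ { refl → y≢ refl })

  ∈-image-remove⁻ : ∀ {S a y} → y ∈ image (S - a) → y ∈ image S
  ∈-image-remove⁻ {S} = image-mono λ b∈ → proj₁ (∈-remove⁻ S b∈)

  image-remove-twin : ∀ {S a} → ∃ (Twin S a) → image (S - a) ≡ image S
  image-remove-twin {S} {a} (b , b∈S , b≢a , qb≡qa) =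
    ⊆-antisym (∈-image-remove⁻ {S}) (λ {y} → from y)
    where
    from : ∀ y → y ∈ image S → y ∈ image (S - a)
    from y y∈ with y ≟ q a
    ... | yes refl = subst (_∈ image (S - a)) qb≡qa (∈-image⁺ (x∈p∧x≢y⇒x∈p-y b∈S b≢a))
    ... | no y≢    = ∈-image-remove⁺ y∈ y≢

  ∉-image-remove : ∀ {S a} → ¬ ∃ (Twin S a) → q a ∉ image (S - a)
  ∉-image-remove {S} no-twin qa∈ with b , b∈ , e ← ∈-image⁻ qa∈ =
    no-twin (b , proj₁ (∈-remove⁻ S b∈) , proj₂ (∈-remove⁻ S b∈) , e)

  del-restrict : ∀ S Δ a → ¬ ∃ (Twin S a) →
    Restrict (image (S - a)) Δ ≐ del (Restrict (image S) Δ) (q a)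
  del-restrict S Δ a no-twin = (λ {K} → to K) , (λ {K} → from K)
    where
    to : ∀ K → Restrict (image (S - a)) Δ K → del (Restrict (image S) Δ) (q a) K
    to K (K⊆ , k) =
      (λ qa∈ → ∉-image-remove no-twin (K⊆ qa∈)) , (λ y∈ → ∈-image-remove⁻ {S} (K⊆ y∈)) , k
    from : ∀ K → del (Restrict (image S) Δ) (q a) K → Restrict (image (S - a)) Δ K
    from K (qa∉ , K⊆ , k) = (λ y∈ → ∈-image-remove⁺ {S} {a} (K⊆ y∈) λ { refl → qa∉ y∈ }) , k

  link-restrict : ∀ S Δ a → a ∈ S →
    Restrict (image (S - a)) (link Δ (q a)) ≐ link (Restrict (image S) Δ) (q a)
  link-restrict S Δ a a∈S = (λ {K} → to K) , (λ {K} → from K)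
    where
    to : ∀ K → Restrict (image (S - a)) (link Δ (q a)) K → link (Restrict (image S) Δ) (q a) K
    to K (K⊆ , qa∉ , k) =
      qa∉ , insert-⊆ (∈-image⁺ a∈S) (λ y∈ → ∈-image-remove⁻ {S} (K⊆ y∈)) , k
    from : ∀ K → link (Restrict (image S) Δ) (q a) K → Restrict (image (S - a)) (link Δ (q a)) K
    from K (qa∉ , ⊆S , k) =
      (λ y∈ → ∈-image-remove⁺ {S} {a} (⊆S (⊆-insert (q a) K y∈)) λ { refl → qa∉ y∈ }) , qa∉ , k

  restrict-absorb : ∀ {T Δ} → (∀ {K} → Δ K → K ⊆ T) → Restrict T Δ ≐ Δ
  restrict-absorb {T} {Δ} Δ⊆T = (λ (_ , k) → k) , (λ {K} → from K)
    where
    from : ∀ K → Δ K → Restrict T Δ K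
    from K k = Δ⊆T k , k

  -- Shedding a vertex outside `S`, or a copy that has a twin, leaves the underlying complex alone,
  -- so only the deletion branch is followed; shedding a last copy sheds `q a` below. `Γ` is fixed
  -- only up to `≐`, which keeps the recursion on literal subderivations.
  VD-blow⁻ : ∀ {Γ} S Δ → Γ ≐ Blow S Δ → VertexDecomposable Γ →
    VertexDecomposable (Restrict (image S) Δ)
  VD-blow⁻ S Δ e (simplex pure (F , fF , uniq)) =
    simplex (blow-pure⁻ (pure-resp e pure))
      (image F , blow-facet⁻ (facet-resp e fF) , λ K fK →
        let L , fL , imL≡K = lift-facet fK
        in trans (sym imL≡K) (cong image (uniq L (facet-resp (≐-sym e) fL))))
  VD-blow⁻ S Δ e (decomp pure a d l) with a ∈? S
  ... | no a∉S =
    VD-blow⁻ S Δ (≐-trans (del-resp e a)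
      ((λ (_ , f) → f) , λ { f@(F⊆S , _) → (λ a∈F → a∉S (F⊆S a∈F)) , f })) d
  ... | yes a∈S with twin? S a
  ...   | yes twin = subst (λ T → VertexDecomposable (Restrict T Δ)) (image-remove-twin twin)
    (VD-blow⁻ (S - a) Δ (≐-trans (del-resp e a) (del-blow S Δ a)) d)
  ...   | no no-twin = decomp (blow-pure⁻ (pure-resp e pure)) (q a)
    (VD-resp (del-restrict S Δ a no-twin)
      (VD-blow⁻ (S - a) Δ (≐-trans (del-resp e a) (del-blow S Δ a)) d))
    (VD-resp (link-restrict S Δ a a∈S)
      (VD-blow⁻ (S - a) (link Δ (q a)) (≐-trans (link-resp e a) (link-blow S Δ a a∈S)) l))

  -- The outer recursion follows the decomposition of `Δ`, the inner one removes the copies of the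
  -- shed vertex `k` one by one. Each copy has as its link a blow-up of `link Δ k`, and once the
  -- last copy is gone a blow-up of `del Δ k` remains.
  VD-blow⁺ : ∀ {Δ} → FullyDecomposable Δ → ∀ S → (∀ {K} → Δ K → K ⊆ image S) →
    VertexDecomposable (Blow S Δ)
  VD-blow⁺ {Δ} (trivial (to , from)) S _ =
    VD-trivial (only , λ { refl → face })
    where
    only : ∀ {F} → Blow S Δ F → F ≡ ⊥
    only {F} (_ , _ , f) =
      Empty-unique λ (a , a∈F) → ∉⊥ (subst (q a ∈_) (to f) (∈-image⁺ a∈F))
    image-⊥ : image ⊥ ≡ ⊥
    image-⊥ = Empty-unique λ (y , y∈) → ∉⊥ (proj₁ (proj₂ (∈-image⁻ {⊥} y∈)))
    face : Blow S Δ ⊥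
    face = (λ x∈ → ⊥-elim (∉⊥ x∈)) , (λ _ _ a∈ → ⊥-elim (∉⊥ a∈)) , from image-⊥
  VD-blow⁺ {Δ} (shed pure k d l) S₀ cover₀ = go ∣ S₀ ∣ S₀ ≤-refl cover₀
    where
    go : ∀ c S → ∣ S ∣ ≤ c → (∀ {K} → Δ K → K ⊆ image S) → VertexDecomposable (Blow S Δ)
    go c S ∣S∣≤c cover with hits S k
    -- The link of `k` has a face, so `k` lies in a face of `Δ` and the covering assumption provides
    -- a copy.
    ... | no no-copy with G , _ , g ← FD-face l =
      contradiction (∈-image⁻ (cover g (∈-insert k G))) no-copy
    go c S ∣S∣≤c cover | yes (a , a∈S , refl) =
      decomp (blow-pure⁺ (pure-resp (≐-sym (restrict-absorb cover)) pure)) a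
        (VD-resp (≐-sym (del-blow S Δ a)) (deletion c ∣S∣≤c))
        (VD-resp (≐-sym (link-blow S Δ a a∈S)) (VD-blow⁺ l (S - a) λ (qa∉ , k) y∈ →
          ∈-image-remove⁺ {S} {a} (cover k (⊆-insert (q a) _ y∈)) λ { refl → qa∉ y∈ }))
      where
      deletion : ∀ c → ∣ S ∣ ≤ c → VertexDecomposable (Blow (S - a) Δ)
      deletion c ∣S∣≤c with twin? S a
      deletion zero ∣S∣≤c | yes _ = ⊥-elim (<⇒≱ (x∈p⇒∣p-x∣<∣p∣ a∈S) (≤-trans ∣S∣≤c z≤n))
      deletion (suc c) ∣S∣≤c | yes twin =
        go c (S - a) (s≤s⁻¹ (<-≤-trans (x∈p⇒∣p-x∣<∣p∣ a∈S) ∣S∣≤c))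
          λ k → subst (_ ⊆_) (sym (image-remove-twin twin)) (cover k)
      deletion c ∣S∣≤c | no no-twin =
        VD-resp ((λ {F} → to F) , (λ {F} → from F))
          (VD-blow⁺ d (S - a) λ (qa∉ , k) y∈ → ∈-image-remove⁺ {S} {a} (cover k y∈) λ { refl → qa∉ y∈ })
        where
        to : ∀ F → Blow (S - a) (del Δ (q a)) F → Blow (S - a) Δ F
        to F (F⊆ , inj , _ , f) = (λ {x} → F⊆ {x}) , inj , f
        from : ∀ F → Blow (S - a) Δ F → Blow (S - a) (del Δ (q a)) F
        from F (F⊆ , inj , f) =
          (λ {x} → F⊆ {x}) , inj , (λ qa∈ → ∉-image-remove no-twin (image-mono F⊆ qa∈)) , f

-- Shellings from rank functions

-- A shelling order given by a function on facets; facets of equal rank may come in any order.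
record RankShelling (Δ : Complex n) : Set where
  field
    rank : Subset n → ℕ
    step : ∀ {F K} → IsFacet Δ F → IsFacet Δ K → K ≢ F → rank K ≤ rank F →
           ∃ λ x → x ∈ F × x ∉ K × ∃ λ L → IsFacet Δ L × rank L < rank F × Sheds x F L
open RankShelling

_≟ˢ_ : (F K : Subset n) → Dec (F ≡ K)
_≟ˢ_ = ≡-dec Bool._≟_

rankShelling-resp : {Δ Γ : Complex n} → Δ ≐ Γ → RankShelling Δ → RankShelling Γ
rankShelling-resp e R = record
  { rank = rank R
  ; step = λ fF fK K≢F K≤F →
      let x , x∈F , x∉K , L , fL , rest =
            step R (facet-resp (≐-sym e) fF) (facet-resp (≐-sym e) fK) K≢F K≤F
      in x , x∈F , x∉K , L , facet-resp e fL , rest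
  }

shellable⇒rankShelling : {Δ : Complex n} → Shellable Δ → RankShelling Δ
shellable⇒rankShelling {n} {Δ} (_ , s , F , facets , complete , injective , shelling) =
  record { rank = index ; step = step′ }
  where
  find : ∀ G → Dec (∃ λ i → F i ≡ G)
  find G = any? λ i → F i ≟ˢ G
  index : Subset n → ℕ
  index G with find G
  ... | yes (i , _) = toℕ i
  -- A default for sets that are not facets; `step` speaks of facets only.
  ... | no _        = 0
  index-F : ∀ i → index (F i) ≡ toℕ i
  index-F i with find (F i)
  ... | yes (j , Fj≡Fi) = cong toℕ (injective Fj≡Fi)
  ... | no none         = contradiction (i , refl) none
  step′ : ∀ {G K} → IsFacet Δ G → IsFacet Δ K → K ≢ G → index K ≤ index G →
    ∃ λ x → x ∈ G × x ∉ K × ∃ λ L → IsFacet Δ L × index L < index G × Sheds x G L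
  step′ {G} {K} fG fK K≢G K≤G with i , refl ← complete G fG | j , refl ← complete K fK
    with x , x∈ , x∉ , k , k<i , diff ← shelling i j
           (≤∧≢⇒< (subst₂ _≤_ (index-F j) (index-F i) K≤G) λ e → K≢G (cong F (toℕ-injective e)))
    = x , x∈ , x∉ , F k , facets k ,
      subst₂ _<_ (sym (index-F k)) (sym (index-F i)) k<i , ─≡⇒sheds diff

-- A face is a facet exactly when the facet found above it is the face itself.
facet? : {Δ : Complex n} → Simplicial Δ → ∀ F → Dec (IsFacet Δ F)
facet? S F with dec S F
... | no ¬f = no (¬f ∘ proj₁)
... | yes f with K , F⊆K , fK ← extend S f with F ≟ˢ K
...   | yes refl = yes fK
...   | no F≢K   = no λ fF → F≢K (sym (proj₂ fF K (proj₁ fK) F⊆K))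

-- Enumeration of all subsets

subsets : ∀ n → List (Subset n)
subsets zero    = [] ∷ []
subsets (suc n) = cartesianProductWith _∷_ (inside ∷ outside ∷ []) (subsets n)

∈-subsets : (F : Subset n) → F ∈ˡ subsets n
∈-subsets []            = here refl
∈-subsets (inside  ∷ F) = ∈-cartesianProductWith⁺ _∷_ {xs = inside ∷ outside ∷ []} (here refl) (∈-subsets F)
∈-subsets (outside ∷ F) = ∈-cartesianProductWith⁺ _∷_ {xs = inside ∷ outside ∷ []} (there (here refl)) (∈-subsets F)

subsets-unique : ∀ n → Unique (subsets n)
subsets-unique zero    = [] ∷ []
subsets-unique (suc n) =
  cartesianProductWith⁺ _∷_ (λ { refl → refl , refl }) (((λ ()) ∷ []) ∷ [] ∷ []) (subsets-unique n)

lookup-AllPairs : ∀ {A : Set} {R : A → A → Set} {xs} → AllPairs R xs →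
  ∀ {i j} → toℕ i < toℕ j → R (List.lookup xs i) (List.lookup xs j)
lookup-AllPairs (rs ∷ _)  {zero}  {suc j} _   = All.lookup rs (∈-lookup j)
lookup-AllPairs (_ ∷ rss) {suc i} {suc j} i<j = lookup-AllPairs rss (s≤s⁻¹ i<j)

-- The facets are listed without repetition and sorted by rank. Ties do no harm: `step` accepts an
-- earlier facet of equal rank and returns one of strictly smaller rank, which must come earlier in
-- the list.
rankShelling⇒shellable : {Δ : Complex n} → Simplicial Δ → Pure Δ → RankShelling Δ → Shellable Δ
rankShelling⇒shellable {n} {Δ} S pure R =
  pure , List.length facets , F , facet-F , complete , injective , shelling
  where
  byRank : DecTotalOrder _ _ _
  byRank = On.decTotalOrder ≤-decTotalOrder (rank R)
  open Sort byRank using (sort; sort-↭; sort-↗)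
  unsorted facets : List (Subset n)
  unsorted = List.filter (facet? S) (subsets n)
  facets   = sort unsorted
  F : Fin (List.length facets) → Subset n
  F = List.lookup facets
  facet-F : ∀ i → IsFacet Δ (F i)
  facet-F i = proj₂ (∈-filter⁻ (facet? S) {xs = subsets n} (∈-resp-↭ (sort-↭ unsorted) (∈-lookup i)))
  complete : ∀ G → IsFacet Δ G → ∃ λ i → F i ≡ G
  complete G fG = Any.index G∈ , sym (lookup-index G∈)
    where
    G∈ : G ∈ˡ facets
    G∈ = ∈-resp-↭ (↭-sym (sort-↭ unsorted)) (∈-filter⁺ (facet? S) (∈-subsets G) fG)
  ordered : ∀ {i j} → toℕ i < toℕ j → rank R (F i) ≤ rank R (F j)
  ordered = lookup-AllPairs (Sorted⇒AllPairs (DecTotalOrder.totalOrder byRank) (sort-↗ unsorted))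
  distinct : ∀ {i j} → toℕ i < toℕ j → F i ≢ F j
  distinct = lookup-AllPairs
    (Unique-resp-↭ (setoid (Subset n)) (↭⇒↭ₛ (↭-sym (sort-↭ unsorted)))
      (filter⁺ (facet? S) (subsets-unique n)))
  injective : ∀ {i j} → F i ≡ F j → i ≡ j
  injective {i} {j} e with <-cmp (toℕ i) (toℕ j)
  ... | tri< i<j _ _ = contradiction e (distinct i<j)
  ... | tri≈ _ i≡j _ = toℕ-injective i≡j
  ... | tri> _ _ j<i = contradiction (sym e) (distinct j<i)
  shelling : ∀ i j → toℕ j < toℕ i → ∃ λ x → x ∈ F i × x ∉ F j ×
    ∃ λ k → toℕ k < toℕ i × F i ─ F k ≡ ⁅ x ⁆
  shelling i j j<i with x , x∈ , x∉ , L , fL , L<Fi , sheds ←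
                          step R (facet-F i) (facet-F j) (distinct j<i) (ordered j<i)
    with k , refl ← complete L fL = x , x∈ , x∉ , k , k<i , sheds⇒─≡ sheds
    where
    k<i : toℕ k < toℕ i
    k<i with <-cmp (toℕ k) (toℕ i)
    ... | tri< k<i _ _ = k<i
    ... | tri≈ _ k≡i _ = contradiction (cong (rank R ∘ F) (toℕ-injective k≡i)) (<⇒≢ L<Fi)
    ... | tri> _ _ i<k = contradiction (ordered i<k) (<⇒≱ L<Fi)

-- Of two distinct facets, one of no smaller rank is moved by a single step to a facet of smaller
-- rank, so the sum of the two ranks decreases until the facets agree.
shellable⇒connected : {Δ : Complex n} → Shellable Δ → Connected Δ
shellable⇒connected {Δ = Δ} sh φ adj {F} {K} fF fK = go _ fF fK ≤-refl
  where
  R : RankShelling Δ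
  R = shellable⇒rankShelling sh
  go : ∀ c {F K} → IsFacet Δ F → IsFacet Δ K → rank R F + rank R K ≤ c → φ F ≡ φ K
  descend : ∀ c {F K} → IsFacet Δ F → IsFacet Δ K → K ≢ F → rank R K ≤ rank R F →
    rank R F + rank R K ≤ c → φ F ≡ φ K
  go c {F} {K} fF fK ≤c with F ≟ˢ K | ≤-total (rank R K) (rank R F)
  ... | yes F≡K | _        = cong φ F≡K
  ... | no F≢K  | inj₁ K≤F = descend c fF fK (F≢K ∘ sym) K≤F ≤c
  ... | no F≢K  | inj₂ F≤K =
    sym (descend c fK fF F≢K F≤K (subst (_≤ c) (+-comm (rank R F) _) ≤c))
  descend c {F} fF fK K≢F K≤F ≤c with x , _ , _ , L , fL , L<F , sheds ← step R fF fK K≢F K≤F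
    with c
  ... | zero  = contradiction (≤-trans (m≤m+n (rank R F) _) ≤c) (<⇒≱ (≤-<-trans z≤n L<F))
  ... | suc c = trans (adj fF fL sheds) (go c fL fK (s≤s⁻¹ (≤-trans (+-monoˡ-≤ _ L<F) ≤c)))

-- Subsets of a product, row by row

sum-mono-≤ : ∀ {f g : Fin n → ℕ} → (∀ w → f w ≤ g w) → sum f ≤ sum g
sum-mono-≤ {zero}  f≤g = z≤n
sum-mono-≤ {suc n} f≤g = +-mono-≤ (f≤g zero) (sum-mono-≤ (f≤g ∘ suc))

sum-mono-< : ∀ {f g : Fin n → ℕ} → (∀ w → f w ≤ g w) → ∀ {v} → f v < g v → sum f < sum g
sum-mono-< f≤g {zero}  f<g = +-mono-<-≤ f<g (sum-mono-≤ (f≤g ∘ suc))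
sum-mono-< f≤g {suc v} f<g = +-mono-≤-< (f≤g zero) (sum-mono-< (f≤g ∘ suc) f<g)

∣++∣ : (F : Subset n) (K : Subset m) → ∣ F ++ K ∣ ≡ ∣ F ∣ + ∣ K ∣
∣++∣ []            K = refl
∣++∣ (inside  ∷ F) K = cong suc (∣++∣ F K)
∣++∣ (outside ∷ F) K = ∣++∣ F K

set : ∀ {a} {A : Set a} → (Fin n → A) → Fin n → A → Fin n → A
set f w y = updateAt f w λ _ → y

set-elim : ∀ {a p} {A : Set a} (P : Fin n → A → Set p) f w y →
  P w y → (∀ v → v ≢ w → P v (f v)) → ∀ v → P v (set f w y v)
set-elim P f w y Py Pf v with v ≟ w
... | yes refl = subst (P v) (sym (updateAt-updates v f)) Py
... | no v≢w   = subst (P v) (sym (updateAt-minimal v w f v≢w)) (Pf v v≢w)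

assemble : (Fin n → Subset m) → Subset (n * m)
assemble R = concat (tabulate R)

∣assemble∣ : (R : Fin n → Subset m) → ∣ assemble R ∣ ≡ sum (∣_∣ ∘ R)
∣assemble∣ {zero}  R = refl
∣assemble∣ {suc n} R = trans (∣++∣ (R zero) _) (cong (∣ R zero ∣ +_) (∣assemble∣ (R ∘ suc)))

module Rows (n m : ℕ) where

  row : Fin n → Subset (n * m) → Subset m
  row w F = tabulate (λ x → lookup F (combine w x))

  row-assemble : (R : Fin n → Subset m) → ∀ w → row w (assemble R) ≡ R w
  row-assemble R w = trans
    (tabulate-cong λ x → trans (lookup-concat (tabulate R) w x)
                               (cong (λ K → lookup K x) (lookup∘tabulate R w)))
    (tabulate∘lookup (R w))

  ∈-row⁺ : ∀ {w : Fin n} {x : Fin m} {F} → combine w x ∈ F → x ∈ row w F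
  ∈-row⁺ {x = x} x∈ = lookup⇒[]= x _ (trans (lookup∘tabulate _ x) ([]=⇒lookup x∈))

  ∈-row⁻ : ∀ {w : Fin n} {x : Fin m} {F} → x ∈ row w F → combine w x ∈ F
  ∈-row⁻ {x = x} x∈ = lookup⇒[]= _ _ (trans (sym (lookup∘tabulate _ x)) ([]=⇒lookup x∈))

  row-mono : ∀ {F K : Subset (n * m)} → F ⊆ K → ∀ w → row w F ⊆ row w K
  row-mono {F = F} F⊆K w x∈ = ∈-row⁺ (F⊆K (∈-row⁻ {F = F} x∈))

  rows-⊆ : ∀ {F K : Subset (n * m)} → (∀ w → row w F ⊆ row w K) → F ⊆ K
  rows-⊆ rows {a} a∈ with w , x , refl ← combine-surjective {n} {m} a =
    ∈-row⁻ (rows w (∈-row⁺ a∈))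

  rows-≡ : ∀ {F K : Subset (n * m)} → (∀ w → row w F ≡ row w K) → F ≡ K
  rows-≡ {F = F} rows = ⊆-antisym
    (rows-⊆ λ w → ⊆-reflexive (rows w))
    (rows-⊆ {K = F} λ w → ⊆-reflexive (sym (rows w)))

  ∣rows∣ : (F : Subset (n * m)) → ∣ F ∣ ≡ sum (λ w → ∣ row w F ∣)
  ∣rows∣ F =
    trans (cong ∣_∣ (rows-≡ {F = F} {assemble λ v → row v F} λ w → sym (row-assemble (λ v → row v F) w)))
      (∣assemble∣ (λ w → row w F))

  replace : Fin n → Subset m → Subset (n * m) → Subset (n * m)
  replace w K F = assemble (set (λ v → row v F) w K)

  row-replace : ∀ (w : Fin n) (K : Subset m) F → row w (replace w K F) ≡ K
  row-replace w K F = trans (row-assemble _ w) (updateAt-updates w (λ v → row v F))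

  row-replace-≢ : ∀ {w v : Fin n} (K : Subset m) F → v ≢ w → row v (replace w K F) ≡ row v F
  row-replace-≢ {w = w} {v} K F v≢w =
    trans (row-assemble _ v) (updateAt-minimal v w (λ u → row u F) v≢w)

  replace-elim : ∀ {p} (P : Fin n → Subset m → Set p) w K F →
    P w K → (∀ v → v ≢ w → P v (row v F)) → ∀ v → P v (row v (replace w K F))
  replace-elim P w K F PK PF v =
    subst (P v) (sym (row-assemble (set (λ u → row u F) w K) v)) (set-elim P (λ u → row u F) w K PK PF v)

  ∣replace∣ : ∀ (w : Fin n) {K L : Subset m} F → ∣ K ∣ < ∣ L ∣ → ∣ replace w K F ∣ < ∣ replace w L F ∣
  ∣replace∣ w {K} {L} F K<L =
    subst₂ _<_ (sym (∣rows∣ (replace w K F))) (sym (∣rows∣ (replace w L F)))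
      (sum-mono-<
        (replace-elim (λ v S → ∣ S ∣ ≤ ∣ row v (replace w L F) ∣) w K F
          (subst (λ S → _ ≤ ∣ S ∣) (sym (row-replace w L F)) (<⇒≤ K<L))
          (λ v v≢w → ≤-reflexive (cong ∣_∣ (sym (row-replace-≢ L F v≢w)))))
        {w} (subst₂ (λ S T → ∣ S ∣ < ∣ T ∣)
              (sym (row-replace w K F)) (sym (row-replace w L F)) K<L))

  -- Lets purity descend to a single row: exchanging one row while fixing the others changes the
  -- total size strictly monotonically.
  ∣replace∣-injective : ∀ (w : Fin n) {K L : Subset m} F →
    ∣ replace w K F ∣ ≡ ∣ replace w L F ∣ → ∣ K ∣ ≡ ∣ L ∣
  ∣replace∣-injective w {K} {L} F e with <-cmp ∣ K ∣ ∣ L ∣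
  ... | tri< K<L _ _ = contradiction e (<⇒≢ (∣replace∣ w F K<L))
  ... | tri≈ _ K≡L _ = K≡L
  ... | tri> _ _ L<K = contradiction (sym e) (<⇒≢ (∣replace∣ w F L<K))

  -- Joins

  -- The factors may vary with the row, because deletion and link at a vertex change the factor of
  -- one row only.
  Join : (Fin n → Complex m) → Complex (n * m)
  Join Δs F = ∀ w → Δs w (row w F)

  join-cong : {Δs Γs : Fin n → Complex m} → (∀ w → Δs w ≡ Γs w) → Join Δs ≐ Join Γs
  join-cong e = (λ f w → subst (λ Δ → Δ _) (e w) (f w)) ,
                (λ f w → subst (λ Δ → Δ _) (sym (e w)) (f w))

  join-facet⁺ : {Δs : Fin n → Complex m} → ∀ {F} →
    (∀ w → IsFacet (Δs w) (row w F)) → IsFacet (Join Δs) F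
  join-facet⁺ fF = (proj₁ ∘ fF) , λ K k F⊆K →
    rows-≡ λ w → proj₂ (fF w) _ (k w) (row-mono F⊆K w)

  join-facet⁻ : {Δs : Fin n → Complex m} → ∀ {F} →
    IsFacet (Join Δs) F → ∀ w → IsFacet (Δs w) (row w F)
  join-facet⁻ {Δs = Δs} {F} (f , max) w = f w , λ K k row⊆K →
    trans (sym (row-replace w K F)) (cong (row w)
      (max (replace w K F)
        (replace-elim (λ v S → Δs v S) w K F k (λ v _ → f v))
        (rows-⊆ {F = F} (replace-elim (λ v S → row v F ⊆ S) w K F row⊆K λ _ _ x∈ → x∈))))

  join-replace : {Δs : Fin n → Complex m} → ∀ {F} → IsFacet (Join Δs) F →
    ∀ w {K} → IsFacet (Δs w) K → IsFacet (Join Δs) (replace w K F)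
  join-replace {Δs = Δs} {F} fF w {K} fK =
    join-facet⁺ (replace-elim (λ v S → IsFacet (Δs v) S) w K F fK λ v _ → join-facet⁻ fF v)

  join-pure⁺ : {Δs : Fin n → Complex m} → (∀ w → Pure (Δs w)) → Pure (Join Δs)
  join-pure⁺ pure F K fF fK =
    trans (∣rows∣ F) (trans
      (sum-cong-≗ λ w → pure w _ _ (join-facet⁻ fF w) (join-facet⁻ fK w))
      (sym (∣rows∣ K)))

  join-pure⁻ : {Δs : Fin n → Complex m} → ∀ {F} → IsFacet (Join Δs) F →
    Pure (Join Δs) → ∀ w → Pure (Δs w)
  join-pure⁻ {F = F} fF pure w K L fK fL =
    ∣replace∣-injective w F (pure _ _ (join-replace fF w fK) (join-replace fF w fL))

  row-insert-≡ : ∀ (w : Fin n) (x : Fin m) F → row w (⁅ combine w x ⁆ ∪ F) ≡ ⁅ x ⁆ ∪ row w F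
  row-insert-≡ w x F = ⊆-antisym to
    (insert-⊆ (∈-row⁺ (∈-insert (combine w x) F)) λ y∈ → ∈-row⁺ (⊆-insert (combine w x) F (∈-row⁻ {F = F} y∈)))
    where
    to : row w (⁅ combine w x ⁆ ∪ F) ⊆ ⁅ x ⁆ ∪ row w F
    to {y} y∈ with ∈-insert⁻ F (∈-row⁻ {w = w} {F = ⁅ combine w x ⁆ ∪ F} y∈)
    ... | inj₁ e   = subst (_∈ ⁅ x ⁆ ∪ row w F) (sym (combine-injectiveʳ w y w x e)) (∈-insert x _)
    ... | inj₂ y∈F = ⊆-insert x _ (∈-row⁺ y∈F)

  row-insert-≢ : ∀ {w v : Fin n} (x : Fin m) F → v ≢ w → row v (⁅ combine w x ⁆ ∪ F) ≡ row v F
  row-insert-≢ {w = w} {v} x F v≢w =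
    ⊆-antisym to λ y∈ → ∈-row⁺ (⊆-insert (combine w x) F (∈-row⁻ {F = F} y∈))
    where
    to : row v (⁅ combine w x ⁆ ∪ F) ⊆ row v F
    to {y} y∈ with ∈-insert⁻ F (∈-row⁻ {w = v} {F = ⁅ combine w x ⁆ ∪ F} y∈)
    ... | inj₁ e   = contradiction (combine-injectiveˡ v y w x e) v≢w
    ... | inj₂ y∈F = ∈-row⁺ y∈F

  -- Vertex decomposability and shellability of joins

  del-join : ∀ (Δs : Fin n → Complex m) w x →
    del (Join Δs) (combine w x) ≐ Join (set Δs w (del (Δs w) x))
  del-join Δs w x = (λ {F} → to F) , (λ {F} → from F)
    where
    to : ∀ F → del (Join Δs) (combine w x) F → Join (set Δs w (del (Δs w) x)) F
    to F (x∉ , f) = set-elim (λ v Δ → Δ (row v F)) Δs w (del (Δs w) x) ((λ x∈ → x∉ (∈-row⁻ x∈)) , f w) (λ v _ → f v)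
    from : ∀ F → Join (set Δs w (del (Δs w) x)) F → del (Join Δs) (combine w x) F
    from F f = (λ x∈ → proj₁ at-w (∈-row⁺ x∈)) , others
      where
      at-w : del (Δs w) x (row w F)
      at-w = subst (λ Δ → Δ (row w F)) (updateAt-updates w Δs) (f w)
      others : ∀ v → Δs v (row v F)
      others v with v ≟ w
      ... | yes refl = proj₂ at-w
      ... | no v≢w   = subst (λ Δ → Δ (row v F)) (updateAt-minimal v w Δs v≢w) (f v)

  link-join : ∀ (Δs : Fin n → Complex m) w x →
    link (Join Δs) (combine w x) ≐ Join (set Δs w (link (Δs w) x))
  link-join Δs w x = (λ {F} → to F) , (λ {F} → from F)
    where
    to : ∀ F → link (Join Δs) (combine w x) F → Join (set Δs w (link (Δs w) x)) F
    to F (x∉ , f) = set-elim (λ v Δ → Δ (row v F)) Δs w (link (Δs w) x)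
      ((λ x∈ → x∉ (∈-row⁻ x∈)) , subst (Δs w) (row-insert-≡ w x F) (f w))
      (λ v v≢w → subst (Δs v) (row-insert-≢ x F v≢w) (f v))
    from : ∀ F → Join (set Δs w (link (Δs w) x)) F → link (Join Δs) (combine w x) F
    from F f = (λ x∈ → proj₁ at-w (∈-row⁺ x∈)) , others
      where
      at-w : link (Δs w) x (row w F)
      at-w = subst (λ Δ → Δ (row w F)) (updateAt-updates w Δs) (f w)
      others : ∀ v → Δs v (row v (⁅ combine w x ⁆ ∪ F))
      others v with v ≟ w
      ... | yes refl = subst (Δs v) (sym (row-insert-≡ v x F)) (proj₂ at-w)
      ... | no v≢w   = subst (Δs v) (sym (row-insert-≢ x F v≢w))
                         (subst (λ Δ → Δ (row v F)) (updateAt-minimal v w Δs v≢w) (f v))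

  -- A vertex shed in another row does not affect factor `w`, so its deletion branch is followed; a
  -- vertex shed in row `w` is shed in the factor as well.
  VD-join⁻ : ∀ {Γ} (Δs : Fin n → Complex m) → Γ ≐ Join Δs →
    VertexDecomposable Γ → ∀ w → VertexDecomposable (Δs w)
  VD-join⁻ Δs e (simplex pure (F , fF , uniq)) w =
    simplex (join-pure⁻ fF′ (pure-resp e pure) w)
      (row w F , join-facet⁻ fF′ w , λ K fK →
        trans (sym (row-replace w K F))
          (cong (row w) (uniq _ (facet-resp (≐-sym e) (join-replace fF′ w fK)))))
    where
    fF′ : IsFacet (Join Δs) F
    fF′ = facet-resp e fF
  VD-join⁻ Δs e D@(decomp pure a d l) w
    with u , x , refl ← combine-surjective {n} {m} a with w ≟ u
  ... | no w≢u = subst VertexDecomposable (updateAt-minimal w u Δs w≢u)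
    (VD-join⁻ (set Δs u (del (Δs u) x)) (≐-trans (del-resp e a) (del-join Δs u x)) d w)
  ... | yes refl = decomp
    -- Purity of a factor needs a facet of the join into which facets of the factor can be inserted;
    -- decomposability supplies one.
    (join-pure⁻ (facet-resp e (proj₂ (VD-facet D))) (pure-resp e pure) w) x
    (subst VertexDecomposable (updateAt-updates w Δs)
      (VD-join⁻ (set Δs w (del (Δs w) x)) (≐-trans (del-resp e a) (del-join Δs w x)) d w))
    (subst VertexDecomposable (updateAt-updates w Δs)
      (VD-join⁻ (set Δs w (link (Δs w) x)) (≐-trans (link-resp e a) (link-join Δs w x)) l w))

  -- The factors are treated one after another, the last one first. The full decomposition of a
  -- factor is replayed inside the join, and each of its branches ends with that factor equal to
  -- `{∅}`.
  VD-join⁺ : (Δs : Fin n → Complex m) → (∀ w → FullyDecomposable (Δs w)) →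
    VertexDecomposable (Join Δs)
  VD-join⁺ Δs fds = go n ≤-refl Δs fds λ w n≤w → contradiction n≤w (<⇒≱ (toℕ<n w))
    where
    -- Only the first k factors are not yet reduced to {∅}.
    go : ∀ k → k ≤ n → (Δs : Fin n → Complex m) → (∀ w → FullyDecomposable (Δs w)) →
      (∀ w → k ≤ toℕ w → Δs w ≐ (_≡ ⊥)) → VertexDecomposable (Join Δs)
    go zero _ Δs fds triv = VD-trivial ((λ {F} → to F) , λ { refl → from })
      where
      row-⊥ : ∀ w → row w ⊥ ≡ ⊥
      row-⊥ w = Empty-unique λ (x , x∈) → ∉⊥ (∈-row⁻ x∈)
      to : ∀ F → Join Δs F → F ≡ ⊥
      to F f = rows-≡ λ w → trans (proj₁ (triv w z≤n) (f w)) (sym (row-⊥ w))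
      from : Join Δs ⊥
      from w = proj₂ (triv w z≤n) (row-⊥ w)
    go (suc k) k<n Δs fds triv =
      -- Writing `Δs` as its own update at `w` lets `reduce` recurse on an arbitrary complex in that
      -- row.
      VD-resp (join-cong (updateAt-id-local w Δs refl)) (reduce (fds w))
      where
      w : Fin n
      w = fromℕ< k<n
      reduce : ∀ {Δ} → FullyDecomposable Δ → VertexDecomposable (Join (set Δs w Δ))
      reduce {Δ} D@(trivial t) = go k (<⇒≤ k<n) (set Δs w Δ)
        (set-elim (λ _ → FullyDecomposable) Δs w Δ D λ v _ → fds v)
        (set-elim (λ v Γ → k ≤ toℕ v → Γ ≐ (_≡ ⊥)) Δs w Δ (λ _ → t) λ v v≢w k≤v →
          triv v (≤∧≢⇒< k≤v λ k≡v → v≢w (toℕ-injective (trans (sym k≡v) (sym (toℕ-fromℕ< k<n))))))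
      reduce {Δ} (shed pure x d l) = decomp
        (join-pure⁺ (set-elim (λ _ → Pure) Δs w Δ pure λ v _ → FD-pure (fds v)))
        (combine w x)
        (VD-resp (≐-sym (≐-trans (del-join (set Δs w Δ) w x) (join-cong (same (λ Γ → del Γ x))))) (reduce d))
        (VD-resp (≐-sym (≐-trans (link-join (set Δs w Δ) w x) (join-cong (same (λ Γ → link Γ x))))) (reduce l))
        where
        same : ∀ (f : Complex m → Complex m) v →
          set (set Δs w Δ) w (f (set Δs w Δ w)) v ≡ set Δs w (f Δ) v
        same f v = updateAt-updateAt-local w Δs (cong f (updateAt-updates w Δs)) v

  -- All rows except `w` are frozen to those of a facet `F₀`. A step removes a vertex of row `w`, so
  -- the new facet contains the other rows of `F₀`; these are facets, hence unchanged.
  rank-join⁻ : {Δs : Fin n → Complex m} → ∀ {F} → IsFacet (Join Δs) F →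
    RankShelling (Join Δs) → ∀ w → RankShelling (Δs w)
  rank-join⁻ {Δs} {F₀} fF₀ R w = record
    { rank = λ K → rank R (replace w K F₀)
    ; step = step′
    }
    where
    step′ : ∀ {F K} → IsFacet (Δs w) F → IsFacet (Δs w) K → K ≢ F →
      rank R (replace w K F₀) ≤ rank R (replace w F F₀) →
      ∃ λ x → x ∈ F × x ∉ K × ∃ λ L → IsFacet (Δs w) L ×
        rank R (replace w L F₀) < rank R (replace w F F₀) × Sheds x F L
    step′ {F} {K} fF fK K≢F K≤F
      with a , a∈ , a∉ , L , fL , L< , (_ , a∉L , rest) ←
             step R (join-replace fF₀ w fF) (join-replace fF₀ w fK)
               (λ e → K≢F (trans (sym (row-replace w K F₀))
                             (trans (cong (row w) e) (row-replace w F F₀)))) K≤F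
      with v , x , refl ← combine-surjective {n} {m} a
      with v ≟ w
    ... | no v≢w = contradiction
      (∈-row⁻ (subst (x ∈_)
        (trans (row-replace-≢ F F₀ v≢w) (sym (row-replace-≢ K F₀ v≢w))) (∈-row⁺ a∈))) a∉
    ... | yes refl =
      x , x∈F , (λ x∈K → a∉ (∈-row⁻ (subst (x ∈_) (sym (row-replace w K F₀)) x∈K))) ,
      row w L , join-facet⁻ fL w , subst (λ T → rank R T < _) (sym same) L< ,
      x∈F , (λ x∈L → a∉L (∈-row⁻ x∈L)) , λ y y∈F y≢x →
        ∈-row⁺ (rest (combine w y) (∈-row⁻ (subst (y ∈_) (sym (row-replace w F F₀)) y∈F))
          λ e → y≢x (combine-injectiveʳ w y w x e))
      where
      x∈F : x ∈ F
      x∈F = subst (x ∈_) (row-replace w F F₀) (∈-row⁺ a∈)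
      F₀⊆L : ∀ u → u ≢ w → row u F₀ ⊆ row u L
      F₀⊆L u u≢w {y} y∈ = ∈-row⁺ (rest (combine u y)
        (∈-row⁻ (subst (y ∈_) (sym (row-replace-≢ F F₀ u≢w)) y∈))
        λ e → u≢w (combine-injectiveˡ u y w x e))
      same : replace w (row w L) F₀ ≡ L
      same = rows-≡ (replace-elim (λ u T → T ≡ row u L) w (row w L) F₀ refl λ u u≢w →
        sym (proj₂ (join-facet⁻ {Δs} fF₀ u) _ (proj₁ (join-facet⁻ {Δs} fL u)) (F₀⊆L u u≢w)))

-- Independence complexes

independent? : (G : Graph n) → ∀ W → Dec (Independent G W)
independent? G W = all? λ x → all? λ y →
  (x ∈? W) →-dec ((y ∈? W) →-dec ¬? (adj G x y Bool.≟ true))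

independent-⊆ : ∀ (G : Graph n) {W V} → V ⊆ W → Independent G W → Independent G V
independent-⊆ G V⊆W ind x y x∈ y∈ = ind x y (V⊆W x∈) (V⊆W y∈)

Ind-simplicial : (G : Graph n) → Simplicial (Ind G)
Ind-simplicial G = record { dec = independent? G ; down = independent-⊆ G }

⊥-independent : (G : Graph n) → Independent G ⊥
⊥-independent G x _ x∈ = ⊥-elim (∉⊥ x∈)

⁅⁆-independent : (G : Graph n) → ∀ x → Independent G ⁅ x ⁆
⁅⁆-independent G x y z y∈ z∈ e
  with refl ← x∈⁅y⁆⇒x≡y x y∈ | refl ← x∈⁅y⁆⇒x≡y x z∈ with () ← trans (sym (irrefl G x)) e

Ind-facet-nonempty : ∀ (G : Graph n) {F} → Fin n → IsFacet (Ind G) F → Nonempty F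
Ind-facet-nonempty G {F} x (_ , max) with nonempty? F
... | yes ne   = ne
... | no empty with refl ← Empty-unique empty =
  x , subst (x ∈_) (max ⁅ x ⁆ (⁅⁆-independent G x) (⊆-min ⁅ x ⁆)) (x∈⁅x⁆ x)

¬edgeFree⇒edge : (G : Graph n) → ¬ EdgeFree G → ∃ λ u → ∃ λ v → Edge G u v
¬edgeFree⇒edge G ¬free with any? (λ u → any? (λ v → adj G u v Bool.≟ true))
... | yes e = e
... | no ¬e = contradiction (λ u v e → ¬e (u , v , e)) ¬free

edgeFree-facet : ∀ {G : Graph n} {F} → EdgeFree G → IsFacet (Ind G) F → F ≡ ⊤
edgeFree-facet free (_ , max) = sym (max ⊤ (λ x y _ _ → free x y) ⊆⊤)

edgeFree-pure : ∀ {G : Graph n} → EdgeFree G → Pure (Ind G)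
edgeFree-pure {G = G} free F K fF fK =
  cong ∣_∣ (trans (edgeFree-facet {G = G} free fF) (sym (edgeFree-facet {G = G} free fK)))

edgeFree-rankShelling : ∀ {G : Graph n} → EdgeFree G → RankShelling (Ind G)
edgeFree-rankShelling {G = G} free = record
  { rank = λ _ → 0
  ; step = λ fF fK K≢F →
      contradiction (trans (edgeFree-facet {G = G} free fK) (sym (edgeFree-facet {G = G} free fF))) K≢F
  }

complete-independent : ∀ {H : Graph m} {F x y} → IsComplete H → Independent H F →
  x ∈ F → y ∈ F → x ≡ y
complete-independent {x = x} {y} complete ind x∈ y∈ with x ≟ y
... | yes x≡y = x≡y
... | no x≢y  = contradiction (complete x y x≢y) (ind x y x∈ y∈)

complete-facet : ∀ {H : Graph m} {F} → IsComplete H → Fin m → IsFacet (Ind H) F →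
  ∃ λ x → F ≡ ⁅ x ⁆
complete-facet {H = H} {F} complete x₀ fF@(ind , _) with x , x∈F ← Ind-facet-nonempty H x₀ fF =
  x , ⊆-antisym (λ y∈ → subst (_∈ ⁅ x ⁆) (complete-independent {H = H} complete ind x∈F y∈) (x∈⁅x⁆ x))
                (λ y∈ → subst (_∈ F) (sym (x∈⁅y⁆⇒x≡y x y∈)) x∈F)

complete-pure : ∀ {H : Graph m} → IsComplete H → Fin m → Pure (Ind H)
complete-pure {H = H} complete x₀ F K fF fK
  with x , refl ← complete-facet {H = H} complete x₀ fF
     | y , refl ← complete-facet {H = H} complete x₀ fK = trans (∣⁅x⁆∣≡1 x) (sym (∣⁅x⁆∣≡1 y))

complete-rankShelling : ∀ {H : Graph m} → IsComplete H → Fin m → RankShelling (Ind H)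
complete-rankShelling {m} {H} complete x₀ = record { rank = position ; step = step′ }
  where
  position : Subset m → ℕ
  position F with nonempty? F
  ... | yes (x , _) = toℕ x
  ... | no _        = 0
  position-⁅⁆ : ∀ x → position ⁅ x ⁆ ≡ toℕ x
  position-⁅⁆ x with nonempty? ⁅ x ⁆
  ... | yes (_ , y∈) = cong toℕ (x∈⁅y⁆⇒x≡y x y∈)
  ... | no empty     = contradiction (x , x∈⁅x⁆ x) empty
  step′ : ∀ {F K} → IsFacet (Ind H) F → IsFacet (Ind H) K → K ≢ F → position K ≤ position F →
    ∃ λ x → x ∈ F × x ∉ K × ∃ λ L → IsFacet (Ind H) L × position L < position F × Sheds x F L
  step′ fF fK K≢F K≤F with x , refl ← complete-facet {H = H} complete x₀ fF
                         | y , refl ← complete-facet {H = H} complete x₀ fK =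
    -- The facets are singletons, so the earlier facet `⁅ y ⁆` itself is the one reached by removing
    -- `x`.
    x , x∈⁅x⁆ x , x∉ , ⁅ y ⁆ , fK ,
    ≤∧≢⇒< K≤F (λ e → y≢x (toℕ-injective (trans (sym (position-⁅⁆ y)) (trans e (position-⁅⁆ x))))) ,
    x∈⁅x⁆ x , x∉ , λ z z∈ z≢x → contradiction (x∈⁅y⁆⇒x≡y x z∈) z≢x
    where
    y≢x : y ≢ x
    y≢x refl = K≢F refl
    x∉ : x ∉ ⁅ y ⁆
    x∉ x∈ = y≢x (sym (x∈⁅y⁆⇒x≡y y x∈))

-- Supplies the weight by which supports dominate rows in a lexicographic rank. The sum of the two
-- bounds stands in for their maximum.
bounded : (f : Subset n → ℕ) → ∃ λ b → ∀ F → f F ≤ b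
bounded {zero}  f = f [] , λ { [] → ≤-refl }
bounded {suc n} f with a , ≤a ← bounded (f ∘ (inside ∷_)) | b , ≤b ← bounded (f ∘ (outside ∷_)) =
  a + b , λ { (inside  ∷ F) → ≤-trans (≤a F) (m≤m+n a b)
            ; (outside ∷ F) → ≤-trans (≤b F) (m≤n+m b a) }

indicator : Bool → ℕ
indicator true  = 1
indicator false = 0

∣∣≡sum : (F : Subset n) → ∣ F ∣ ≡ sum (indicator ∘ lookup F)
∣∣≡sum []            = refl
∣∣≡sum (inside  ∷ F) = cong suc (∣∣≡sum F)
∣∣≡sum (outside ∷ F) = ∣∣≡sum F

-- Independence complexes of lexicographic products

-- The vertex `x₀` makes every facet of `Ind H` nonempty and puts every vertex of `G` into the
-- support of some facet.
module Lex {n m : ℕ} (G : Graph n) (H : Graph m) (x₀ : Fin m) where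
  open Rows n m
  open Blowup {n * m} {n} (λ a → proj₁ (remQuot m a)) renaming (image to support)

  ∈-support⁺ : ∀ {F w x} → x ∈ row w F → w ∈ support F
  ∈-support⁺ {F} {w} {x} x∈ =
    subst (_∈ support F) (cong proj₁ (remQuot-combine w x)) (∈-image⁺ (∈-row⁻ x∈))

  ∈-support⁻ : ∀ {F w} → w ∈ support F → Nonempty (row w F)
  ∈-support⁻ {F} w∈ with a , a∈F , refl ← ∈-image⁻ w∈ =
    proj₂ (remQuot {n} m a) , ∈-row⁺ (subst (_∈ F) (sym (combine-remQuot {n} m a)) a∈F)

  row-∉-support : ∀ {F w} → w ∉ support F → row w F ≡ ⊥
  row-∉-support w∉ = Empty-unique λ (x , x∈) → w∉ (∈-support⁺ x∈)

  adj-lex : ∀ w x y z → adj (G [ H ]ₗ) (combine w x) (combine y z) ≡ lexAdj G H (w , x) (y , z)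
  adj-lex w x y z = cong₂ (lexAdj G H) (remQuot-combine w x) (remQuot-combine y z)

  edge-lex⁺ˡ : ∀ {w x y z} → Edge G w y → Edge (G [ H ]ₗ) (combine w x) (combine y z)
  edge-lex⁺ˡ {w} {x} {y} {z} e =
    trans (adj-lex w x y z) (cong (Bool._∨ (⌊ w ≟ y ⌋ Bool.∧ adj H x z)) e)

  edge-lex⁺ʳ : ∀ {w x z} → Edge H x z → Edge (G [ H ]ₗ) (combine w x) (combine w z)
  edge-lex⁺ʳ {w} {x} {z} e = trans (adj-lex w x w z) (right e)
    where
    right : Edge H x z → lexAdj G H (w , x) (w , z) ≡ true
    right e rewrite irrefl G w with w ≟ w
    ... | yes _  = e
    ... | no w≢w = contradiction refl w≢w

  edge-lex⁻ : ∀ {w x y z} → Edge (G [ H ]ₗ) (combine w x) (combine y z) →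
    Edge G w y ⊎ (w ≡ y × Edge H x z)
  edge-lex⁻ {w} {x} {y} {z} e = split (trans (sym (adj-lex w x y z)) e)
    where
    split : lexAdj G H (w , x) (y , z) ≡ true → Edge G w y ⊎ (w ≡ y × Edge H x z)
    split e with adj G w y in eq | w ≟ y
    ... | true  | _       = inj₁ refl
    ... | false | yes w≡y = inj₂ (w≡y , e)
    ... | false | no _    with () ← e

  Δ : Complex (n * m)
  Δ = Ind (G [ H ]ₗ)

  ind-lex : Δ ≐ λ F → Ind G (support F) × ∀ w → Ind H (row w F)
  ind-lex = (λ {F} → to F) , (λ {F} → from F)
    where
    to : ∀ F → Δ F → Ind G (support F) × ∀ w → Ind H (row w F)
    to F ind =
      (λ w y w∈ y∈ e →
        let x , x∈ = ∈-support⁻ w∈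
            z , z∈ = ∈-support⁻ y∈
        in ind _ _ (∈-row⁻ x∈) (∈-row⁻ z∈) (edge-lex⁺ˡ e)) ,
      (λ w x z x∈ z∈ e → ind _ _ (∈-row⁻ x∈) (∈-row⁻ z∈) (edge-lex⁺ʳ e))
    from : ∀ F → (Ind G (support F) × ∀ w → Ind H (row w F)) → Δ F
    from F (indG , indH) a b a∈ b∈ e
      with w , x , refl ← combine-surjective {n} {m} a | y , z , refl ← combine-surjective {n} {m} b
      with edge-lex⁻ {w} {x} {y} {z} e
    ... | inj₁ e′          = indG w y (∈-support⁺ (∈-row⁺ a∈)) (∈-support⁺ (∈-row⁺ b∈)) e′
    ... | inj₂ (refl , e′) = indH w x z (∈-row⁺ a∈) (∈-row⁺ b∈) e′

  Δ-simplicial : Simplicial Δ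
  Δ-simplicial = Ind-simplicial (G [ H ]ₗ)

  facet-row-nonempty : ∀ {K} → IsFacet (Ind H) K → Nonempty K
  facet-row-nonempty = Ind-facet-nonempty H x₀

  H-facet : ∃ (IsFacet (Ind H))
  H-facet with L , _ , fL ← extend (Ind-simplicial H) (⊥-independent H) = L , fL

  -- Changing rows and supports

  support-replace : ∀ {F w K} → w ∈ support F → Nonempty K → support (replace w K F) ≡ support F
  support-replace {F} {w} {K} w∈ (x , x∈K) = ⊆-antisym (λ {v} → to v) (λ {v} → from v)
    where
    to : ∀ v → v ∈ support (replace w K F) → v ∈ support F
    to v v∈ with v ≟ w
    ... | yes refl = w∈
    ... | no v≢w with y , y∈ ← ∈-support⁻ v∈ =
      ∈-support⁺ (subst (y ∈_) (row-replace-≢ K F v≢w) y∈)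
    from : ∀ v → v ∈ support F → v ∈ support (replace w K F)
    from v v∈ with v ≟ w
    ... | yes refl = ∈-support⁺ (subst (x ∈_) (sym (row-replace w K F)) x∈K)
    ... | no v≢w with y , y∈ ← ∈-support⁻ v∈ =
      ∈-support⁺ (subst (y ∈_) (sym (row-replace-≢ K F v≢w)) y∈)

  -- Serves to move `F` to the support `S` while keeping as much of `F` as `S` allows, both for
  -- enlarging faces and for steps of a shelling.
  transplantRow : Subset n → Subset m → Subset (n * m) → Fin n → Subset m
  transplantRow S L F w with w ∈? S | w ∈? support F
  ... | yes _ | yes _ = row w F
  ... | yes _ | no _  = L
  ... | no _  | _     = ⊥

  transplant : Subset n → Subset m → Subset (n * m) → Subset (n * m)
  transplant S L F = assemble (transplantRow S L F)

  transplant-elim : ∀ {p} (P : Fin n → Subset m → Set p) S L F →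
    (∀ w → w ∈ S → w ∈ support F → P w (row w F)) →
    (∀ w → w ∈ S → w ∉ support F → P w L) →
    (∀ w → w ∉ S → P w ⊥) →
    ∀ w → P w (row w (transplant S L F))
  transplant-elim P S L F old new out w = subst (P w) (sym (row-assemble (transplantRow S L F) w)) cases
    where
    cases : P w (transplantRow S L F w)
    cases with w ∈? S | w ∈? support F
    ... | yes w∈S | yes w∈F = old w w∈S w∈F
    ... | yes w∈S | no w∉F  = new w w∈S w∉F
    ... | no w∉S  | _       = out w w∉S

  support-transplant : ∀ S {L} F → Nonempty L → support (transplant S L F) ≡ S
  support-transplant S {L} F ne = ⊆-antisym (λ {w} → to w) (λ {w} → from w)
    where
    to : ∀ w → w ∈ support (transplant S L F) → w ∈ S
    to w w∈ = transplant-elim (λ w T → Nonempty T → w ∈ S) S L F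
      (λ _ w∈S _ _ → w∈S) (λ _ w∈S _ _ → w∈S) (λ _ _ (_ , x∈⊥) → ⊥-elim (∉⊥ x∈⊥))
      w (∈-support⁻ w∈)
    from : ∀ w → w ∈ S → w ∈ support (transplant S L F)
    from w w∈S = ∈-support⁺ (proj₂ (transplant-elim (λ w T → w ∈ S → Nonempty T) S L F
      (λ _ _ w∈F _ → ∈-support⁻ w∈F) (λ _ _ _ _ → ne) (λ _ w∉S w∈S → contradiction w∈S w∉S) w w∈S))

  FacetRows : Subset (n * m) → Set
  FacetRows F = ∀ w → w ∈ support F → IsFacet (Ind H) (row w F)

  -- A larger face has the same support by maximality of the support, and then the same rows by
  -- maximality of each.
  lex-facet⁺ : ∀ {F} → IsFacet (Ind G) (support F) → FacetRows F → IsFacet Δ F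
  lex-facet⁺ {F} (indG , maxG) facets = proj₂ ind-lex (indG , indH) , max
    where
    indH : ∀ w → Ind H (row w F)
    indH w with w ∈? support F
    ... | yes w∈ = proj₁ (facets w w∈)
    ... | no w∉  = subst (Ind H) (sym (row-∉-support w∉)) (⊥-independent H)
    max : ∀ K → Δ K → F ⊆ K → K ≡ F
    max K k F⊆K with indG′ , indH′ ← proj₁ ind-lex k = rows-≡ same
      where
      same-support : support K ≡ support F
      same-support = maxG _ indG′ (image-mono F⊆K)
      same : ∀ w → row w K ≡ row w F
      same w with w ∈? support F
      ... | yes w∈ = proj₂ (facets w w∈) _ (indH′ w) (row-mono F⊆K w)
      ... | no w∉  = trans (row-∉-support (w∉ ∘ subst (w ∈_) same-support))
                           (sym (row-∉-support w∉))

  -- A larger independent support can be filled with copies of `⁅ x₀ ⁆`, and a larger independent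
  -- row can be put in place of the old one; either would enlarge `F`.
  lex-facet⁻ : ∀ {F} → IsFacet Δ F → IsFacet (Ind G) (support F) × FacetRows F
  lex-facet⁻ {F} (f , max) = (indG , maxG) , λ w w∈ → indH w , maxH w w∈
    where
    indG : Ind G (support F)
    indG = proj₁ (proj₁ ind-lex f)
    indH : ∀ w → Ind H (row w F)
    indH = proj₂ (proj₁ ind-lex f)
    maxG : ∀ S → Ind G S → support F ⊆ S → S ≡ support F
    maxG S s ⊆S = trans (sym supp) (cong support (max _ face F⊆))
      where
      supp : support (transplant S ⁅ x₀ ⁆ F) ≡ S
      supp = support-transplant S F (x₀ , x∈⁅x⁆ x₀)
      face : Δ (transplant S ⁅ x₀ ⁆ F)
      face = proj₂ ind-lex (subst (Ind G) (sym supp) s ,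
        transplant-elim (λ _ → Ind H) S ⁅ x₀ ⁆ F
          (λ w _ _ → indH w) (λ _ _ _ → ⁅⁆-independent H x₀) (λ _ _ → ⊥-independent H))
      F⊆ : F ⊆ transplant S ⁅ x₀ ⁆ F
      F⊆ = rows-⊆ (transplant-elim (λ w T → row w F ⊆ T) S ⁅ x₀ ⁆ F
        (λ _ _ _ x∈ → x∈)
        (λ _ _ w∉ x∈ → contradiction (∈-support⁺ x∈) w∉)
        (λ _ w∉ x∈ → contradiction (⊆S (∈-support⁺ x∈)) w∉))
    maxH : ∀ w → w ∈ support F → ∀ L → Ind H L → row w F ⊆ L → L ≡ row w F
    maxH w w∈ L l row⊆L =
      trans (sym (row-replace w L F)) (cong (row w) (max (replace w L F) face F⊆))
      where
      ne : Nonempty L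
      ne with x , x∈ ← ∈-support⁻ w∈ = x , row⊆L x∈
      face : Δ (replace w L F)
      face = proj₂ ind-lex (subst (Ind G) (sym (support-replace w∈ ne)) indG ,
        replace-elim (λ _ → Ind H) w L F l (λ v _ → indH v))
      F⊆ : F ⊆ replace w L F
      F⊆ = rows-⊆ (replace-elim (λ v T → row v F ⊆ T) w L F row⊆L λ _ _ x∈ → x∈)

  lex-replace : ∀ {F w K} → IsFacet Δ F → w ∈ support F → IsFacet (Ind H) K →
    IsFacet Δ (replace w K F)
  lex-replace {F} {w} {K} fF w∈ fK with fG , rows ← lex-facet⁻ fF =
    lex-facet⁺ (subst (IsFacet (Ind G)) (sym supp) fG) λ v v∈ →
      replace-elim (λ v T → v ∈ support F → IsFacet (Ind H) T) w K F (λ _ → fK) (λ v _ → rows v)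
        v (subst (v ∈_) supp v∈)
    where
    supp : support (replace w K F) ≡ support F
    supp = support-replace w∈ (facet-row-nonempty fK)

  lex-transplant : ∀ {F S L} → IsFacet Δ F → IsFacet (Ind G) S → IsFacet (Ind H) L →
    IsFacet Δ (transplant S L F)
  lex-transplant {F} {S} {L} fF fS fL with _ , rows ← lex-facet⁻ fF =
    lex-facet⁺ (subst (IsFacet (Ind G)) (sym supp) fS) λ v v∈ →
      transplant-elim (λ v T → v ∈ S → IsFacet (Ind H) T) S L F
        (λ v _ v∈F _ → rows v v∈F) (λ _ _ _ _ → fL) (λ _ v∉ v∈ → contradiction v∈ v∉)
        v (subst (v ∈_) supp v∈)
    where
    supp : support (transplant S L F) ≡ S
    supp = support-transplant S F (facet-row-nonempty fL)

  facet-through : ∀ w → ∃ λ F → IsFacet Δ F × w ∈ support F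
  facet-through w
    with F , ⊆F , fF ← extend Δ-simplicial (⁅⁆-independent (G [ H ]ₗ) (combine w x₀)) =
    F , fF , ∈-support⁺ {x = x₀} (∈-row⁺ (⊆F (x∈⁅x⁆ _)))

  -- Purity of `Ind H` gives every nonempty row the size of one fixed facet `L`, so the size of a
  -- facet depends only on that of its support.
  lex-pure⁺ : Pure (Ind G) → Pure (Ind H) → Pure Δ
  lex-pure⁺ pureG pureH F K fF fK = trans (size fF) (trans
    (cong (∣ L ∣ *_) (pureG _ _ (proj₁ (lex-facet⁻ fF)) (proj₁ (lex-facet⁻ fK)))) (sym (size fK)))
    where
    L : Subset m
    L = proj₁ H-facet
    size : ∀ {F} → IsFacet Δ F → ∣ F ∣ ≡ ∣ L ∣ * ∣ support F ∣
    size {F} fF = begin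
      ∣ F ∣                                            ≡⟨ ∣rows∣ F ⟩
      sum (λ w → ∣ row w F ∣)                          ≡⟨ sum-cong-≗ size-row ⟩
      sum (λ w → ∣ L ∣ * indicator (lookup (support F) w)) ≡⟨ *-distribˡ-sum ∣ L ∣ (indicator ∘ lookup (support F)) ⟨
      ∣ L ∣ * sum (indicator ∘ lookup (support F))     ≡⟨ cong (∣ L ∣ *_) (∣∣≡sum (support F)) ⟨
      ∣ L ∣ * ∣ support F ∣                            ∎
      where
      open ≡-Reasoning
      size-row : ∀ w → ∣ row w F ∣ ≡ ∣ L ∣ * indicator (lookup (support F) w)
      size-row w with lookup (support F) w in eq
      ... | true  = trans
        (pureH _ _ (proj₂ (lex-facet⁻ fF) w (lookup⇒[]= w _ eq)) (proj₂ H-facet))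
        (sym (*-identityʳ ∣ L ∣))
      ... | false = trans
        (cong ∣_∣ (row-∉-support {F} λ w∈ → contradiction (trans (sym ([]=⇒lookup w∈)) eq) λ ()))
        (trans (∣⊥∣≡0 m) (sym (*-zeroʳ ∣ L ∣)))

  lex-pure⁻ : Fin n → Pure Δ → Pure (Ind H)
  lex-pure⁻ w pure K L fK fL with F , fF , w∈ ← facet-through w =
    ∣replace∣-injective w F (pure _ _ (lex-replace fF w∈ fK) (lex-replace fF w∈ fL))

  -- If distinct `x` and `z` are not adjacent, supports are constant along single steps and hence on
  -- all facets. Facets through the two ends of an edge of `G` then share a support that contains
  -- the edge, which is impossible.
  connected⇒complete : ¬ EdgeFree G → Pure Δ → Connected Δ → IsComplete H
  connected⇒complete ¬free pure connected x z x≢z with adj H x z in eq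
  ... | true  = refl
  ... | false with u , v , e ← ¬edgeFree⇒edge G ¬free
              with Fu , fFu , u∈ ← facet-through u | Fv , fFv , v∈ ← facet-through v =
    contradiction e (proj₁ (proj₁ (lex-facet⁻ fFv)) u v
      (subst (u ∈_) (connected support support-const fFu fFv) u∈) v∈)
    where
    pair : Subset m
    pair = ⁅ x ⁆ ∪ ⁅ z ⁆
    pair-independent : Independent H pair
    pair-independent a b a∈ b∈ e with ∈-insert⁻ ⁅ z ⁆ a∈ | ∈-insert⁻ ⁅ z ⁆ b∈
    ... | inj₁ refl | inj₁ refl with () ← trans (sym (irrefl H x)) e
    ... | inj₁ refl | inj₂ b∈z with refl ← x∈⁅y⁆⇒x≡y z b∈z with () ← trans (sym eq) e
    ... | inj₂ a∈z | inj₁ refl with refl ← x∈⁅y⁆⇒x≡y z a∈z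
                               with () ← trans (sym eq) (trans (symm H x z) e)
    ... | inj₂ a∈z | inj₂ b∈z with refl ← x∈⁅y⁆⇒x≡y z a∈z | refl ← x∈⁅y⁆⇒x≡y z b∈z
                              with () ← trans (sym (irrefl H z)) e
    1<∣pair∣ : 1 < ∣ pair ∣
    1<∣pair∣ = subst (_< ∣ pair ∣) (∣⁅x⁆∣≡1 z) (p⊂q⇒∣p∣<∣q∣
      (⊆-insert x ⁅ z ⁆ , x , ∈-insert x ⁅ z ⁆ , λ x∈ → x≢z (x∈⁅y⁆⇒x≡y z x∈)))
    1<∣facet∣ : ∀ {K} → IsFacet (Ind H) K → 1 < ∣ K ∣
    1<∣facet∣ fK with L , pair⊆L , fL ← extend (Ind-simplicial H) pair-independent =
      subst (1 <_) (lex-pure⁻ u pure _ _ fL fK) (<-≤-trans 1<∣pair∣ (p⊆q⇒∣p∣≤∣q∣ pair⊆L))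
    -- By purity every facet of `Ind H` is as large as one containing `pair`, so it survives the
    -- loss of any one element.
    another : ∀ {K} → IsFacet (Ind H) K → ∀ y → ∃ λ y′ → y′ ∈ K × y′ ≢ y
    another {K} fK y with any? (λ y′ → (y′ ∈? K) ×-dec ¬? (y′ ≟ y))
    ... | yes found = found
    ... | no none   = contradiction
      (≤-trans (p⊆q⇒∣p∣≤∣q∣ K⊆y) (≤-reflexive (∣⁅x⁆∣≡1 y))) (<⇒≱ (1<∣facet∣ fK))
      where
      K⊆y : K ⊆ ⁅ y ⁆
      K⊆y {y′} y′∈ with y′ ≟ y
      ... | yes refl = x∈⁅x⁆ y
      ... | no y′≢y  = contradiction (y′ , y′∈ , y′≢y) none
    -- Every nonempty row of `F` keeps an element in `K`, so one support contains the other, and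
    -- both are facets of `Ind G`.
    support-const : ∀ {F K a} → IsFacet Δ F → IsFacet Δ K → Sheds a F K → support F ≡ support K
    support-const {F} {K} {a} fF fK (_ , _ , rest) =
      sym (proj₂ (proj₁ (lex-facet⁻ fF)) _ (proj₁ (proj₁ (lex-facet⁻ fK))) (λ {w} → sub w))
      where
      sub : ∀ w → w ∈ support F → w ∈ support K
      sub w w∈ with w ∈? support K
      ... | yes w∈K = w∈K
      ... | no w∉K
        with y′ , y′∈ , y′≢ ← another (proj₂ (lex-facet⁻ fF) w w∈) (proj₂ (remQuot {n} m a)) =
        contradiction
          (∈-support⁺ {K} (∈-row⁺ (rest (combine w y′) (∈-row⁻ y′∈)
            λ { refl → y′≢ (sym (cong proj₂ (remQuot-combine w y′))) })))
          w∉K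

  -- For complete `H`, independence of the rows means at most one element in each, which is
  -- injectivity of the projection to `G`.
  blow-lex : IsComplete H → Δ ≐ Blow ⊤ (Ind G)
  blow-lex complete = (λ {F} → to F) , (λ {F} → from F)
    where
    to : ∀ F → Δ F → Blow ⊤ (Ind G) F
    to F f = (λ _ → ∈⊤) , inj , proj₁ (proj₁ ind-lex f)
      where
      inj : InjectiveOn F
      inj a b a∈ b∈ e
        with w , x , refl ← combine-surjective {n} {m} a | y , z , refl ← combine-surjective {n} {m} b
        with refl ← trans (sym (cong proj₁ (remQuot-combine w x)))
                      (trans e (cong proj₁ (remQuot-combine y z))) =
        cong (combine w) (complete-independent {H = H} complete (proj₂ (proj₁ ind-lex f) w)
          (∈-row⁺ a∈) (∈-row⁺ b∈))
    from : ∀ F → Blow ⊤ (Ind G) F → Δ F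
    from F (_ , inj , indG) = proj₂ ind-lex (indG , λ w x z x∈ z∈ e →
      contradiction
        (trans (sym e) (trans (cong (adj H x) (sym (same w x∈ z∈))) (irrefl H x))) λ ())
      where
      same : ∀ w {x z} → x ∈ row w F → z ∈ row w F → x ≡ z
      same w {x} {z} x∈ z∈ = combine-injectiveʳ w x w z
        (inj _ _ (∈-row⁻ x∈) (∈-row⁻ z∈)
          (trans (cong proj₁ (remQuot-combine w x)) (sym (cong proj₁ (remQuot-combine w z)))))

  ⊆-support-⊤ : ∀ {K} → K ⊆ support ⊤
  ⊆-support-⊤ _ = ∈-support⁺ {x = x₀} (∈-row⁺ ∈⊤)

  join-lex : EdgeFree G → Δ ≐ Join (λ _ → Ind H)
  join-lex free = (λ f → proj₂ (proj₁ ind-lex f)) ,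
                  (λ f → proj₂ ind-lex ((λ x y _ _ → free x y) , f))

  -- Facets are compared first by their supports, then by the sum of the ranks of their rows.
  lex-rankShelling : RankShelling (Ind G) → RankShelling (Ind H) →
    (∀ {S T} → IsFacet (Ind G) S → IsFacet (Ind G) T → S ≢ T → IsComplete H) → RankShelling Δ
  lex-rankShelling RG RH complete = record { rank = rank′ ; step = step′ }
    where
    σ : Subset (n * m) → ℕ
    σ F = sum (λ w → rank RH (row w F))
    b : ℕ
    b = proj₁ (bounded σ)
    rank′ : Subset (n * m) → ℕ
    -- Since `σ` never exceeds `b`, the weight `suc b` makes the comparison lexicographic.
    rank′ F = suc b * rank RG (support F) + σ F

    rank-support : ∀ {F K} → rank RG (support F) < rank RG (support K) → rank′ F < rank′ K
    rank-support {F} {K} r<s = begin-strict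
      suc b * r + σ F     <⟨ +-monoʳ-< (suc b * r) (s≤s (proj₂ (bounded σ) F)) ⟩
      suc b * r + suc b   ≡⟨ +-comm (suc b * r) (suc b) ⟩
      suc b + suc b * r   ≡⟨ *-suc (suc b) r ⟨
      suc b * suc r       ≤⟨ *-monoʳ-≤ (suc b) r<s ⟩
      suc b * s           ≤⟨ m≤m+n (suc b * s) (σ K) ⟩
      suc b * s + σ K     ∎
      where
      open ≤-Reasoning
      r s : ℕ
      r = rank RG (support F)
      s = rank RG (support K)

    Step : Subset (n * m) → Subset (n * m) → Set
    Step F K = ∃ λ x → x ∈ F × x ∉ K × ∃ λ L → IsFacet Δ L × rank′ L < rank′ F × Sheds x F L

    -- If all differing rows of `K` had larger rank than those of `F`, the sum `σ` would be larger
    -- for `K` too.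
    lower-row : ∀ {F K} → K ≢ F → support K ≡ support F → rank′ K ≤ rank′ F →
      ∃ λ w → row w K ≢ row w F × rank RH (row w K) ≤ rank RH (row w F)
    lower-row {F} {K} K≢F e K≤F
      with any? (λ w → ¬? (row w K ≟ˢ row w F) ×-dec (rank RH (row w K) ≤? rank RH (row w F)))
    ... | yes found = found
    ... | no none   = contradiction σK≤σF (<⇒≱ σF<σK)
      where
      σK≤σF : σ K ≤ σ F
      σK≤σF = +-cancelˡ-≤ (suc b * rank RG (support F)) _ _
        (subst (λ S → suc b * rank RG S + σ K ≤ rank′ F) e K≤F)
      above : ∀ w → row w K ≢ row w F → rank RH (row w F) < rank RH (row w K)
      above w ne = ≰⇒> λ le → none (w , ne , le)
      weakly : ∀ w → rank RH (row w F) ≤ rank RH (row w K)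
      weakly w with row w K ≟ˢ row w F
      ... | yes same = ≤-reflexive (cong (rank RH) (sym same))
      ... | no ne    = <⇒≤ (above w ne)
      σF<σK : σ F < σ K
      σF<σK with any? (λ w → ¬? (row w K ≟ˢ row w F))
      ... | yes (w , ne) = sum-mono-< weakly {w} (above w ne)
      ... | no same      = contradiction
        (rows-≡ λ w → decidable-stable (row w K ≟ˢ row w F) λ ne → same (w , ne)) K≢F

    -- A step of `Ind H` inside the row just found lowers `σ` and preserves the support.
    same-support : ∀ {F K} → IsFacet Δ F → IsFacet Δ K → K ≢ F → rank′ K ≤ rank′ F →
      support K ≡ support F → Step F K
    same-support {F} {K} fF fK K≢F K≤F e with w , ne , le ← lower-row K≢F e K≤F
      with w ∈? support F
    ... | no w∉ = contradiction
      (trans (row-∉-support (w∉ ∘ subst (w ∈_) e)) (sym (row-∉-support w∉))) ne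
    ... | yes w∈
      with x , x∈ , x∉ , L , fL , L< , (_ , x∉L , rest) ←
             step RH (proj₂ (lex-facet⁻ fF) w w∈)
               (proj₂ (lex-facet⁻ fK) w (subst (w ∈_) (sym e) w∈)) ne le =
      combine w x , ∈-row⁻ x∈ , (λ x∈K → x∉ (∈-row⁺ x∈K)) , replace w L F , lex-replace fF w∈ fL ,
      subst (λ S → suc b * rank RG S + σ (replace w L F) < rank′ F)
        (sym (support-replace w∈ (facet-row-nonempty fL)))
        (+-monoʳ-< (suc b * rank RG (support F)) σ<) ,
      ∈-row⁻ x∈ ,
      (λ x∈L → x∉L (subst (x ∈_) (row-replace w L F) (∈-row⁺ x∈L))) ,
      rest′
      where
      σ< : σ (replace w L F) < σ F
      σ< = sum-mono-<
        (replace-elim (λ v T → rank RH T ≤ rank RH (row v F)) w L F (<⇒≤ L<) λ _ _ → ≤-refl)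
        {w} (subst (λ T → rank RH T < rank RH (row w F)) (sym (row-replace w L F)) L<)
      rest′ : ∀ a → a ∈ F → a ≢ combine w x → a ∈ replace w L F
      rest′ a a∈ a≢ with v , y , refl ← combine-surjective {n} {m} a =
        ∈-row⁻ (replace-elim (λ v T → (v ≡ w → y ≢ x) → y ∈ row v F → y ∈ T) w L F
          (λ y≢x y∈ → rest y y∈ (y≢x refl)) (λ _ _ _ y∈ → y∈) v
          (λ { refl refl → a≢ refl }) (∈-row⁺ a∈))

    -- A step of `Ind G` lowers the rank of the support. Transplanting `F` to the new support `S`
    -- clears row `w` only, and that row is the single vertex `x`.
    different-support : ∀ {F K} → IsFacet Δ F → IsFacet Δ K → rank′ K ≤ rank′ F →
      support K ≢ support F → Step F K
    different-support {F} {K} fF fK K≤F ne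
      with fSF , rowsF ← lex-facet⁻ fF | fSK , _ ← lex-facet⁻ fK
      with w , w∈ , w∉ , S , fS , S< , (_ , w∉S , rest) ← step RG fSF fSK ne
             (≮⇒≥ λ lt → <⇒≱ (rank-support {F} {K} lt) K≤F)
      with x , x∈ ← ∈-support⁻ {F} w∈ =
      combine w x , ∈-row⁻ x∈ , (λ x∈K → w∉ (∈-support⁺ {x = x} (∈-row⁺ x∈K))) ,
      transplant S L F , lex-transplant fF fS fL ,
      rank-support (subst (λ T → rank RG T < rank RG (support F)) (sym supp) S<) ,
      ∈-row⁻ x∈ ,
      (λ x∈T → w∉S (subst (w ∈_) supp (∈-support⁺ {x = x} (∈-row⁺ x∈T)))) ,
      rest′
      where
      L : Subset m
      L = proj₁ H-facet
      fL : IsFacet (Ind H) L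
      fL = proj₂ H-facet
      supp : support (transplant S L F) ≡ S
      supp = support-transplant S F (facet-row-nonempty fL)
      rest′ : ∀ a → a ∈ F → a ≢ combine w x → a ∈ transplant S L F
      rest′ a a∈ a≢ with v , y , refl ← combine-surjective {n} {m} a =
        ∈-row⁻ (transplant-elim (λ v T → v ∈ S → y ∈ row v F → y ∈ T) S L F
          (λ _ _ _ _ y∈ → y∈)
          (λ _ _ v∉ _ y∈ → contradiction (∈-support⁺ y∈) v∉)
          (λ _ v∉ v∈ → contradiction v∈ v∉)
          v (rest v (∈-support⁺ {x = y} (∈-row⁺ a∈)) v≢w) (∈-row⁺ a∈))
        where
        -- The supports differ, so `H` is complete and row `w` of `F` has no element besides `x`.
        v≢w : v ≢ w
        v≢w refl = a≢ (cong (combine w)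
          (complete-independent {H = H} (complete fSK fSF ne) (proj₁ (rowsF w w∈)) (∈-row⁺ a∈) x∈))

    step′ : ∀ {F K} → IsFacet Δ F → IsFacet Δ K → K ≢ F → rank′ K ≤ rank′ F → Step F K
    step′ {F} {K} fF fK K≢F K≤F with support K ≟ˢ support F
    ... | yes e = same-support fF fK K≢F K≤F e
    ... | no ne = different-support fF fK K≤F ne

-- Vertex decomposability and shellability of the lexicographic product

theorem1p1 : ∀ {n m} (G : Graph n) (H : Graph m) → 1 ≤ n → 1 ≤ m →
    (EdgeFree G →
    (VertexDecomposable (Ind H) ⇔ VertexDecomposable (Ind (G [ H ]ₗ)))
    × (Shellable (Ind H) ⇔ Shellable (Ind (G [ H ]ₗ))))
    × (¬ EdgeFree G →
    (VertexDecomposable (Ind (G [ H ]ₗ)) ⇔ (VertexDecomposable (Ind G) × IsComplete H)))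
    × (¬ EdgeFree G →
    (Shellable (Ind G) → IsComplete H → Shellable (Ind (G [ H ]ₗ)))
    × (Shellable (Ind (G [ H ]ₗ)) → IsComplete H))
theorem1p1 {suc n} {suc m} G H _ _ =
  (λ free →
    mk⇔ (λ vd → VD-resp (≐-sym (join-lex free))
                  (VD-join⁺ (λ _ → Ind H) (λ _ → VD⇒FD (Ind-simplicial H) vd)))
        -- Each row is a copy of `Ind H`; the first row exists because `G` has a vertex.
        (λ vd → VD-join⁻ (λ _ → Ind H) (join-lex free) vd zero) ,
    mk⇔ (λ sh → rankShelling⇒shellable Δ-simplicial (lex-pure⁺ (edgeFree-pure {G = G} free) (proj₁ sh))
                  (lex-rankShelling (edgeFree-rankShelling {G = G} free) (shellable⇒rankShelling sh)
                    -- Without edges `⊤` is the only facet of `Ind G`, so two distinct supports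
                    -- cannot occur.
                    λ fS fT S≢T → contradiction
                      (trans (edgeFree-facet {G = G} free fS) (sym (edgeFree-facet {G = G} free fT))) S≢T))
        (λ sh → let _ , fF , _ = facet-through zero in
          rankShelling⇒shellable (Ind-simplicial H) (lex-pure⁻ zero (proj₁ sh))
            (rank-join⁻ {Δs = λ _ → Ind H} (facet-resp (join-lex free) fF)
              (rankShelling-resp (join-lex free) (shellable⇒rankShelling sh)) zero))) ,
  (λ ¬free →
    mk⇔ (λ vd →
          let complete = connected⇒complete ¬free (VD-pure vd) (VD⇒connected Δ-simplicial vd) in
          -- Every vertex of `G` has a copy, so the restriction is `Ind G` itself.
          VD-resp (restrict-absorb λ _ → ⊆-support-⊤) (VD-blow⁻ ⊤ (Ind G) (blow-lex complete) vd) ,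
          complete)
        (λ (vd , complete) → VD-resp (≐-sym (blow-lex complete))
          (VD-blow⁺ (VD⇒FD (Ind-simplicial G) vd) ⊤ λ _ → ⊆-support-⊤))) ,
  (λ ¬free →
    (λ sh complete → rankShelling⇒shellable Δ-simplicial
      (lex-pure⁺ (proj₁ sh) (complete-pure {H = H} complete zero))
      (lex-rankShelling (shellable⇒rankShelling sh) (complete-rankShelling {H = H} complete zero)
        λ _ _ _ → complete)) ,
    (λ sh → connected⇒complete ¬free (proj₁ sh) (shellable⇒connected sh)))
  where
  open Lex G H zero
  open Rows (suc n) (suc m)
  open Blowup {suc n * suc m} {suc n} (λ a → proj₁ (remQuot (suc m) a))
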